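{- For every $\epsilon>0$ there is an instance $(T,s)$ of the firefighter problem on trees (whose size depends on $\epsilon$) such that $$\frac{\mathrm{OPT}(T,s)}{\mathrm{LP}(T,s)} \le 1-\frac1e+\epsilon ,$$ where $\mathrm{OPT}(T,s)$ is the optimal integral value and $\mathrm{LP}(T,s)$ is the optimal fractional value of the canonical LP relaxation.
   Context: An instance is a finite tree $T=(V,E)$ with a source vertex (root) $s\in V$ where the fire starts. A strategy is a sequence of vertices $\mathcal U=\{u_t\}_{t\ge 1}$, where $u_t$ is the vertex picked at time $t$ (one per time step). A vertex $u$ is saved by $\mathcal U$ if on the path $(s=v_0,v_1,\dots,v_z=u)$ from $s$ to $u$ we have $v_i\in\{u_1,\dots,u_i\}$ for some $i\in\{1,\dots,z\}$; otherwise it burns. $\mathrm{OPT}(T,s)$ is the maximum number of vertices saved by a strategy. For $j\ge1$ let $L_j$ (layer $j$) be the set of vertices at distance exactly $j$ from $s$, and let $P_v$ be the set of vertices on the path from $s$ to $v$. The canonical LP relaxation is: maximize $\sum_{v\in V}y_v$ subject to $\sum_{v\in L_j}x_v\le 1$ for every layer $L_j$; $y_v\le\sum_{u\in P_v}x_u$ for every $v\in V$; $x_v,y_v\in[0,1]$ for every $v\in V$; and $x_s=0$ (the source burns and cannot be picked). $\mathrm{LP}(T,s)$ is its optimal value. -}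

module Defs where

open import Data.Nat.Base as ℕ using (ℕ; zero; suc; _!)
import Data.Nat.Properties as ℕₚ
import Data.Integer.Base as ℤ
import Data.Integer.Properties as ℤₚ
open import Data.Rational.Base as ℚ using (ℚ; 0ℚ; 1ℚ; ½; ∣_∣; mkℚ)
import Data.Rational.Properties as ℚₚ
import Data.Rational.Unnormalised.Base as ℚᵘ
import Data.Rational.Unnormalised.Properties as ℚᵘₚ
open import Data.Rational.Solver using (module +-*-Solver)
open import Data.Fin.Base using (Fin; toℕ)
import Data.Fin.Properties as Finₚ
open import Data.List.Base
  using (List; []; _∷_; length; lookup; map; filter; foldr; applyUpTo)
open import Data.List.Membership.Propositional using (_∈_)
open import Data.List.Relation.Unary.Unique.Propositional using (Unique)
import Data.List.Membership.DecPropositional as DecMembership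
open import Data.Product using (∃-syntax; ∃!; _×_; _,_; proj₁; proj₂)
open import Data.Sum.Base using (inj₁; inj₂)
open import Relation.Binary.Definitions using (DecidableEquality; Symmetric)
open import Relation.Binary.PropositionalEquality
  using (_≡_; refl; sym; trans; cong; cong₂; subst; subst₂)
open import Relation.Nullary using (¬_; Dec; _×-dec_)

------------------------------------------------------------------------
-- Real numbers: Cauchy sequences of rationals, compared up to _≃_.

Cauchy : (ℕ → ℚ) → Set
Cauchy f = ∀ δ → 0ℚ ℚ.< δ →
           ∃[ N ] (∀ m n → N ℕ.≤ m → N ℕ.≤ n → ∣ f m ℚ.- f n ∣ ℚ.≤ δ)

record ℝ : Set where
  constructor mkℝ
  field
    seq    : ℕ → ℚ
    cauchy : Cauchy seq
open ℝ public

infix 4 _≤_ _<_ _≃_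

_≤_ : ℝ → ℝ → Set
x ≤ y = ∀ δ → 0ℚ ℚ.< δ →
        ∃[ N ] (∀ n → N ℕ.≤ n → seq x n ℚ.≤ seq y n ℚ.+ δ)

_<_ : ℝ → ℝ → Set
x < y = ∃[ δ ] (0ℚ ℚ.< δ ×
        ∃[ N ] (∀ n → N ℕ.≤ n → seq x n ℚ.+ δ ℚ.≤ seq y n))

_≃_ : ℝ → ℝ → Set
x ≃ y = x ≤ y × y ≤ x

half-pos : ∀ {δ} → 0ℚ ℚ.< δ → 0ℚ ℚ.< ½ ℚ.* δ
half-pos {δ} 0<δ = ℚₚ.positive⁻¹ (½ ℚ.* δ) {{ℚₚ.pos*pos⇒pos ½ δ {{ℚ.positive 0<δ}}}}

half+half : ∀ δ → ½ ℚ.* δ ℚ.+ ½ ℚ.* δ ≡ δ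
half+half δ = trans (sym (ℚₚ.*-distribʳ-+ δ ½ ½)) (ℚₚ.*-identityˡ δ)

∣p-p∣≡0 : ∀ p → ∣ p ℚ.- p ∣ ≡ 0ℚ
∣p-p∣≡0 p = cong ∣_∣ (ℚₚ.+-inverseʳ p)

≤⊔ˡ : ∀ {a b c} → a ℕ.⊔ b ℕ.≤ c → a ℕ.≤ c
≤⊔ˡ {a} {b} = ℕₚ.≤-trans (ℕₚ.m≤m⊔n a b)

≤⊔ʳ : ∀ {a b c} → a ℕ.⊔ b ℕ.≤ c → b ℕ.≤ c
≤⊔ʳ {a} {b} = ℕₚ.≤-trans (ℕₚ.m≤n⊔m a b)

abstract
  const-cauchy : ∀ q → Cauchy (λ _ → q)
  const-cauchy q δ 0<δ = 0 , λ _ _ _ _ →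
    subst (ℚ._≤ δ) (sym (∣p-p∣≡0 q)) (ℚₚ.<⇒≤ 0<δ)

fromℚ : ℚ → ℝ
fromℚ q = mkℝ (λ _ → q) (const-cauchy q)

fromℕ : ℕ → ℝ
fromℕ n = fromℚ (ℤ.+ n ℚ./ 1)

0ℝ 1ℝ : ℝ
0ℝ = fromℕ 0
1ℝ = fromℕ 1

infixl 6 _+_ _-_
infixl 7 _*_
infix  8 -_

abstract
  +-cauchy : ∀ x y → Cauchy (λ n → seq x n ℚ.+ seq y n)
  +-cauchy x y δ 0<δ =
    let (M , p) = cauchy x (½ ℚ.* δ) (half-pos 0<δ)
        (N , q) = cauchy y (½ ℚ.* δ) (half-pos 0<δ)
    in M ℕ.⊔ N , λ m n M⊔N≤m M⊔N≤n →
      let open ℚₚ.≤-Reasoning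
          a = seq x m; b = seq y m; c = seq x n; d = seq y n
      in begin
        ∣ (a ℚ.+ b) ℚ.- (c ℚ.+ d) ∣
          ≡⟨ cong ∣_∣ (+-*-Solver.solve 4 (λ a b c d →
               (a :+ b) :- (c :+ d) := (a :- c) :+ (b :- d)) refl a b c d) ⟩
        ∣ (a ℚ.- c) ℚ.+ (b ℚ.- d) ∣
          ≤⟨ ℚₚ.∣p+q∣≤∣p∣+∣q∣ (a ℚ.- c) (b ℚ.- d) ⟩
        ∣ a ℚ.- c ∣ ℚ.+ ∣ b ℚ.- d ∣
          ≤⟨ ℚₚ.+-mono-≤ (p m n (≤⊔ˡ M⊔N≤m) (≤⊔ˡ M⊔N≤n))
                         (q m n (≤⊔ʳ {M} M⊔N≤m) (≤⊔ʳ {M} M⊔N≤n)) ⟩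
        ½ ℚ.* δ ℚ.+ ½ ℚ.* δ
          ≡⟨ half+half δ ⟩
        δ ∎
    where open +-*-Solver

_+_ : ℝ → ℝ → ℝ
x + y = mkℝ (λ n → seq x n ℚ.+ seq y n) (+-cauchy x y)

abstract
  neg-cauchy : ∀ x → Cauchy (λ n → ℚ.- seq x n)
  neg-cauchy x δ 0<δ =
    let (N , p) = cauchy x δ 0<δ
    in N , λ m n N≤m N≤n → subst (ℚ._≤ δ)
      (trans (sym (ℚₚ.∣-p∣≡∣p∣ (seq x m ℚ.- seq x n)))
             (cong ∣_∣ (ℚₚ.neg-distrib-+ (seq x m) (ℚ.- seq x n))))
      (p m n N≤m N≤n)

-_ : ℝ → ℝ
- x = mkℝ (λ n → ℚ.- seq x n) (neg-cauchy x)

_-_ : ℝ → ℝ → ℝ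
x - y = x + (- y)

-- Cauchy sequences are eventually bounded.
bound : ∀ x → ∃[ B ] (ℚ.Positive B ×
        ∃[ N ] (∀ n → N ℕ.≤ n → ∣ seq x n ∣ ℚ.≤ B))
bound x =
  let (N , p) = cauchy x 1ℚ (ℚₚ.positive⁻¹ 1ℚ)
      b = seq x N
  in 1ℚ ℚ.+ ∣ b ∣
   , ℚ.positive (ℚₚ.+-mono-<-≤ (ℚₚ.positive⁻¹ 1ℚ) (ℚₚ.0≤∣p∣ b))
   , N , λ n N≤n →
     let open ℚₚ.≤-Reasoning
         a = seq x n
     in begin
       ∣ a ∣
         ≡⟨ cong ∣_∣ (+-*-Solver.solve 2 (λ a b → a := (a :- b) :+ b) refl a b) ⟩
       ∣ (a ℚ.- b) ℚ.+ b ∣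
         ≤⟨ ℚₚ.∣p+q∣≤∣p∣+∣q∣ (a ℚ.- b) b ⟩
       ∣ a ℚ.- b ∣ ℚ.+ ∣ b ∣
         ≤⟨ ℚₚ.+-monoˡ-≤ ∣ b ∣ (p n N N≤n ℕₚ.≤-refl) ⟩
       1ℚ ℚ.+ ∣ b ∣ ∎
  where open +-*-Solver

*-mono : ∀ {a b c d} → 0ℚ ℚ.≤ c → 0ℚ ℚ.≤ b → a ℚ.≤ b → c ℚ.≤ d →
         a ℚ.* c ℚ.≤ b ℚ.* d
*-mono {a} {b} {c} {d} 0≤c 0≤b a≤b c≤d = ℚₚ.≤-trans
  (ℚₚ.*-monoʳ-≤-nonNeg c {{ℚ.nonNegative 0≤c}} a≤b)
  (ℚₚ.*-monoˡ-≤-nonNeg b {{ℚ.nonNegative 0≤b}} c≤d)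

share : ℚ → ∀ B → ℚ.Positive B → ℚ
share δ B B>0 = ½ ℚ.* δ ℚ.* (ℚ.1/ B) {{ℚₚ.pos⇒nonZero B {{B>0}}}}

share-pos : ∀ {δ} B B>0 → 0ℚ ℚ.< δ → 0ℚ ℚ.< share δ B B>0
share-pos {δ} B B>0 0<δ = ℚₚ.positive⁻¹ (share δ B B>0)
  {{ℚₚ.pos*pos⇒pos (½ ℚ.* δ) {{ℚ.positive (half-pos 0<δ)}} 1/B {{ℚₚ.1/pos⇒pos B {{B>0}}}}}}
  where 1/B = (ℚ.1/ B) {{ℚₚ.pos⇒nonZero B {{B>0}}}}

share-* : ∀ δ B B>0 → share δ B B>0 ℚ.* B ≡ ½ ℚ.* δ
share-* δ B B>0 = trans (ℚₚ.*-assoc (½ ℚ.* δ) _ B)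
  (trans (cong (½ ℚ.* δ ℚ.*_) (ℚₚ.*-inverseˡ B {{ℚₚ.pos⇒nonZero B {{B>0}}}}))
         (ℚₚ.*-identityʳ (½ ℚ.* δ)))

abstract
  *-cauchy : ∀ x y → Cauchy (λ n → seq x n ℚ.* seq y n)
  *-cauchy x y δ 0<δ =
    let (A , A>0 , Kx , ∣x∣≤A) = bound x
        (B , B>0 , Ky , ∣y∣≤B) = bound y
        (M , p) = cauchy x (share δ B B>0) (share-pos B B>0 0<δ)
        (N , q) = cauchy y (share δ A A>0) (share-pos A A>0 0<δ)
        K = Kx ℕ.⊔ Ky
        L = M ℕ.⊔ N
    in K ℕ.⊔ L , λ m n ≤m ≤n →
      let open ℚₚ.≤-Reasoning
          a = seq x m; b = seq y m; c = seq x n; d = seq y n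
          K≤m = ≤⊔ˡ {K} {L} ≤m; K≤n = ≤⊔ˡ {K} {L} ≤n
          L≤m = ≤⊔ʳ {K} {L} ≤m; L≤n = ≤⊔ʳ {K} {L} ≤n
      in begin
        ∣ a ℚ.* b ℚ.- c ℚ.* d ∣
          ≡⟨ cong ∣_∣ (+-*-Solver.solve 4 (λ a b c d →
               a :* b :- c :* d := (a :- c) :* d :+ (b :- d) :* a) refl a b c d) ⟩
        ∣ (a ℚ.- c) ℚ.* d ℚ.+ (b ℚ.- d) ℚ.* a ∣
          ≤⟨ ℚₚ.∣p+q∣≤∣p∣+∣q∣ ((a ℚ.- c) ℚ.* d) ((b ℚ.- d) ℚ.* a) ⟩
        ∣ (a ℚ.- c) ℚ.* d ∣ ℚ.+ ∣ (b ℚ.- d) ℚ.* a ∣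
          ≡⟨ cong₂ ℚ._+_ (ℚₚ.∣p*q∣≡∣p∣*∣q∣ (a ℚ.- c) d) (ℚₚ.∣p*q∣≡∣p∣*∣q∣ (b ℚ.- d) a) ⟩
        ∣ a ℚ.- c ∣ ℚ.* ∣ d ∣ ℚ.+ ∣ b ℚ.- d ∣ ℚ.* ∣ a ∣
          ≤⟨ ℚₚ.+-mono-≤
               (*-mono (ℚₚ.0≤∣p∣ d) (ℚₚ.<⇒≤ (share-pos B B>0 0<δ))
                 (p m n (≤⊔ˡ {M} {N} L≤m) (≤⊔ˡ {M} {N} L≤n))
                 (∣y∣≤B n (≤⊔ʳ {Kx} {Ky} K≤n)))
               (*-mono (ℚₚ.0≤∣p∣ a) (ℚₚ.<⇒≤ (share-pos A A>0 0<δ))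
                 (q m n (≤⊔ʳ {M} {N} L≤m) (≤⊔ʳ {M} {N} L≤n))
                 (∣x∣≤A m (≤⊔ˡ {Kx} {Ky} K≤m))) ⟩
        share δ B B>0 ℚ.* B ℚ.+ share δ A A>0 ℚ.* A
          ≡⟨ cong₂ ℚ._+_ (share-* δ B B>0) (share-* δ A A>0) ⟩
        ½ ℚ.* δ ℚ.+ ½ ℚ.* δ
          ≡⟨ half+half δ ⟩
        δ ∎
    where open +-*-Solver

_*_ : ℝ → ℝ → ℝ
x * y = mkℝ (λ n → seq x n ℚ.* seq y n) (*-cauchy x y)

⊔-pos : ∀ p {δ} → 0ℚ ℚ.< δ → ℚ.Positive (p ℚ.⊔ δ)
⊔-pos p {δ} 0<δ = ℚ.positive (ℚₚ.<-≤-trans 0<δ (ℚₚ.p≤q⊔p p δ))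

⊔-nonZero : ∀ p {δ} → 0ℚ ℚ.< δ → ℚ.NonZero (p ℚ.⊔ δ)
⊔-nonZero p {δ} 0<δ = ℚₚ.pos⇒nonZero (p ℚ.⊔ δ) {{⊔-pos p 0<δ}}

1/-difference : ∀ a b .{{_ : ℚ.NonZero a}} .{{_ : ℚ.NonZero b}} →
                (ℚ.1/ a ℚ.- ℚ.1/ b) ℚ.* (a ℚ.* b) ≡ ℚ.- (a ℚ.- b)
1/-difference a b = trans
  (+-*-Solver.solve 4 (λ u v a b →
     (u :- v) :* (a :* b) := (u :* a) :* b :- (v :* b) :* a) refl (ℚ.1/ a) (ℚ.1/ b) a b)
  (trans (cong₂ (λ s t → s ℚ.* b ℚ.- t ℚ.* a) (ℚₚ.*-inverseˡ a) (ℚₚ.*-inverseˡ b))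
         (+-*-Solver.solve 2 (λ a b →
            con 1ℚ :* b :- con 1ℚ :* a := :- (a :- b)) refl a b))
  where open +-*-Solver

-- The truncation at the witness δ only affects finitely many terms: past
-- its index N, 0 < x guarantees δ ≤ seq x n.
1/-seq : ∀ x → 0ℝ < x → ℕ → ℚ
1/-seq x (δ , 0<δ , _) n = (ℚ.1/ (seq x n ℚ.⊔ δ)) {{⊔-nonZero (seq x n) 0<δ}}

abstract
  1/-cauchy : ∀ x x>0 → Cauchy (1/-seq x x>0)
  1/-cauchy x x>0@(δ , 0<δ , N , δ≤x) η 0<η =
    let ηδδ = η ℚ.* (δ ℚ.* δ)
        0<ηδδ = ℚₚ.positive⁻¹ ηδδ {{ℚₚ.pos*pos⇒pos η {{ℚ.positive 0<η}} (δ ℚ.* δ)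
          {{ℚₚ.pos*pos⇒pos δ {{ℚ.positive 0<δ}} δ {{ℚ.positive 0<δ}}}}}}
        (M , p) = cauchy x ηδδ 0<ηδδ
    in N ℕ.⊔ M , λ m n ≤m ≤n →
      let open ℚₚ.≤-Reasoning
          a = seq x m ℚ.⊔ δ; b = seq x n ℚ.⊔ δ
          instance
            a>0 = ⊔-pos (seq x m) 0<δ
            b>0 = ⊔-pos (seq x n) 0<δ
            ab>0 = ℚₚ.pos*pos⇒pos a b
            ab≥0 = ℚₚ.pos⇒nonNeg (a ℚ.* b)
            η≥0 = ℚₚ.pos⇒nonNeg η {{ℚ.positive 0<η}}
            a≢0 = ⊔-nonZero (seq x m) 0<δ
            b≢0 = ⊔-nonZero (seq x n) 0<δ
      in ℚₚ.*-cancelʳ-≤-pos (a ℚ.* b) (begin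
        ∣ inv m ℚ.- inv n ∣ ℚ.* (a ℚ.* b)
          ≡⟨ cong (∣ inv m ℚ.- inv n ∣ ℚ.*_) (ℚₚ.0≤p⇒∣p∣≡p (ℚₚ.nonNegative⁻¹ (a ℚ.* b))) ⟨
        ∣ inv m ℚ.- inv n ∣ ℚ.* ∣ a ℚ.* b ∣
          ≡⟨ ℚₚ.∣p*q∣≡∣p∣*∣q∣ (inv m ℚ.- inv n) (a ℚ.* b) ⟨
        ∣ (inv m ℚ.- inv n) ℚ.* (a ℚ.* b) ∣
          ≡⟨ cong ∣_∣ (1/-difference a b) ⟩
        ∣ ℚ.- (a ℚ.- b) ∣
          ≡⟨ ℚₚ.∣-p∣≡∣p∣ (a ℚ.- b) ⟩
        ∣ a ℚ.- b ∣
          ≡⟨ cong₂ (λ s t → ∣ s ℚ.- t ∣) (untruncated m (≤⊔ˡ {N} {M} ≤m))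
                                          (untruncated n (≤⊔ˡ {N} {M} ≤n)) ⟩
        ∣ seq x m ℚ.- seq x n ∣
          ≤⟨ p m n (≤⊔ʳ {N} {M} ≤m) (≤⊔ʳ {N} {M} ≤n) ⟩
        η ℚ.* (δ ℚ.* δ)
          ≤⟨ ℚₚ.*-monoˡ-≤-nonNeg η (*-mono (ℚₚ.<⇒≤ 0<δ) (ℚₚ.<⇒≤ (ℚₚ.positive⁻¹ a))
               (ℚₚ.p≤q⊔p (seq x m) δ) (ℚₚ.p≤q⊔p (seq x n) δ)) ⟩
        η ℚ.* (a ℚ.* b) ∎)
    where
    inv : ℕ → ℚ
    inv = 1/-seq x x>0

    untruncated : ∀ n → N ℕ.≤ n → seq x n ℚ.⊔ δ ≡ seq x n
    untruncated n N≤n = ℚₚ.p≥q⇒p⊔q≡p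
      (subst (ℚ._≤ seq x n) (ℚₚ.+-identityˡ δ) (δ≤x n N≤n))

infix 8 1/_[_]

1/_[_] : ∀ x → 0ℝ < x → ℝ
1/ x [ x>0 ] = mkℝ (1/-seq x x>0) (1/-cauchy x x>0)

infixl 7 _/_[_]

_/_[_] : ℝ → ∀ y → 0ℝ < y → ℝ
x / y [ y>0 ] = x * 1/ y [ y>0 ]

∑ : {A : Set} → List A → (A → ℝ) → ℝ
∑ as f = foldr (λ a r → f a + r) 0ℝ as

------------------------------------------------------------------------
-- e = Σ 1/k!

1/_! : ℕ → ℚ
1/ k ! = (ℤ.+ 1 ℚ./ k !) {{ℕₚ._!≢0 k}}

e-seq : ℕ → ℚ
e-seq zero    = 1/ 0 !
e-seq (suc n) = e-seq n ℚ.+ 1/ suc n !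

1/-pos : ∀ d .{{_ : ℕ.NonZero d}} → 0ℚ ℚ.< ℤ.+ 1 ℚ./ d
1/-pos d = ℚₚ.positive⁻¹ (ℤ.+ 1 ℚ./ d) {{ℚₚ.normalize-pos 1 d}}

e-step : ∀ n → e-seq n ℚ.≤ e-seq (suc n)
e-step n = subst (ℚ._≤ e-seq (suc n)) (ℚₚ.+-identityʳ (e-seq n))
  (ℚₚ.+-monoʳ-≤ (e-seq n) (ℚₚ.<⇒≤ (1/-pos (suc n !) {{ℕₚ._!≢0 (suc n)}})))

e-mono : ∀ {m n} → m ℕ.≤′ n → e-seq m ℚ.≤ e-seq n
e-mono (ℕ.≤′-reflexive refl) = ℚₚ.≤-refl
e-mono (ℕ.≤′-step {n} m≤n)   = ℚₚ.≤-trans (e-mono m≤n) (e-step n)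

/-≤ : ∀ i j c d .{{_ : ℕ.NonZero c}} .{{_ : ℕ.NonZero d}} →
      i ℕ.* d ℕ.≤ j ℕ.* c → ℤ.+ i ℚ./ c ℚ.≤ ℤ.+ j ℚ./ d
/-≤ i j c@(suc c-1) d@(suc d-1) id≤jc = ℚₚ.toℚᵘ-cancel-≤
  (ℚᵘₚ.≤-trans (ℚᵘₚ.≤-reflexive (ℚₚ.toℚᵘ-fromℚᵘ (ℚᵘ.mkℚᵘ (ℤ.+ i) c-1)))
  (ℚᵘₚ.≤-trans (ℚᵘ.*≤* (subst₂ ℤ._≤_ (ℤₚ.pos-* i d) (ℤₚ.pos-* j c) (ℤ.+≤+ id≤jc)))
    (ℚᵘₚ.≤-reflexive (ℚᵘₚ.≃-sym (ℚₚ.toℚᵘ-fromℚᵘ (ℚᵘ.mkℚᵘ (ℤ.+ j) d-1))))))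

halve : ∀ d .{{_ : ℕ.NonZero d}} .{{_ : ℕ.NonZero (2 ℕ.* d)}} →
        ℤ.+ 1 ℚ./ (2 ℕ.* d) ≡ ½ ℚ.* (ℤ.+ 1 ℚ./ d)
halve d@(suc d-1) = ℚₚ.toℚᵘ-injective
  (ℚᵘₚ.≃-trans (ℚₚ.toℚᵘ-fromℚᵘ (ℚᵘ.mkℚᵘ (ℤ.+ 1) (ℕ.pred (2 ℕ.* d))))
  (ℚᵘₚ.≃-sym (ℚᵘₚ.≃-trans (ℚₚ.toℚᵘ-homo-* ½ (ℤ.+ 1 ℚ./ d))
    (ℚᵘₚ.*-cong (ℚᵘₚ.≃-refl {ℚ.toℚᵘ ½}) (ℚₚ.toℚᵘ-fromℚᵘ (ℚᵘ.mkℚᵘ (ℤ.+ 1) d-1))))))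

1/!-halves : ∀ k → 1 ℕ.≤ k → 1/ suc k ! ℚ.≤ ½ ℚ.* 1/ k !
1/!-halves k 1≤k = subst (1/ suc k ! ℚ.≤_) (halve (k !) {{k!≢0}} {{2k!≢0}})
  (/-≤ 1 1 (suc k !) (2 ℕ.* k !) {{ℕₚ._!≢0 (suc k)}} {{2k!≢0}}
    (ℕₚ.*-monoʳ-≤ 1 (ℕₚ.*-monoˡ-≤ (k !) (ℕ.s≤s 1≤k))))
  where
  k!≢0 = ℕₚ._!≢0 k
  2k!≢0 = ℕₚ.m*n≢0 2 (k !) {{_}} {{k!≢0}}

-- e-seq k + 1/k! is decreasing for k ≥ 1, so 1/N! bounds the tail.
tail-step : ∀ k → 1 ℕ.≤ k → e-seq (suc k) ℚ.+ 1/ suc k ! ℚ.≤ e-seq k ℚ.+ 1/ k !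
tail-step k 1≤k = begin
  e-seq k ℚ.+ 1/ suc k ! ℚ.+ 1/ suc k !
    ≡⟨ ℚₚ.+-assoc (e-seq k) (1/ suc k !) (1/ suc k !) ⟩
  e-seq k ℚ.+ (1/ suc k ! ℚ.+ 1/ suc k !)
    ≤⟨ ℚₚ.+-monoʳ-≤ (e-seq k) (ℚₚ.+-mono-≤ (1/!-halves k 1≤k) (1/!-halves k 1≤k)) ⟩
  e-seq k ℚ.+ (½ ℚ.* 1/ k ! ℚ.+ ½ ℚ.* 1/ k !)
    ≡⟨ cong (e-seq k ℚ.+_) (half+half (1/ k !)) ⟩
  e-seq k ℚ.+ 1/ k ! ∎
  where open ℚₚ.≤-Reasoning

e-tail : ∀ {m n} → 1 ℕ.≤ m → m ℕ.≤′ n → e-seq n ℚ.+ 1/ n ! ℚ.≤ e-seq m ℚ.+ 1/ m !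
e-tail 1≤m (ℕ.≤′-reflexive refl) = ℚₚ.≤-refl
e-tail 1≤m (ℕ.≤′-step {n} m≤n)   =
  ℚₚ.≤-trans (tail-step n (ℕₚ.≤-trans 1≤m (ℕₚ.≤′⇒≤ m≤n))) (e-tail 1≤m m≤n)

m≤m! : ∀ m → m ℕ.≤ m !
m≤m! zero    = ℕ.z≤n
m≤m! (suc m) = subst (ℕ._≤ suc m !) (ℕₚ.*-identityʳ (suc m))
  (ℕₚ.*-monoʳ-≤ (suc m) (ℕₚ.1≤n! m))

archimedes : ∀ δ → 0ℚ ℚ.< δ → ∃[ N ] (1 ℕ.≤ N × 1/ N ! ℚ.≤ δ)
archimedes δ@(mkℚ ℤ.+[1+ p ] d-1 _) _ = N , ℕ.s≤s ℕ.z≤n ,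
  subst (1/ N ! ℚ.≤_) (ℚₚ.↥p/↧p≡p δ)
    (/-≤ 1 (suc p) (N !) N {{ℕₚ._!≢0 N}}
      (ℕₚ.*-mono-≤ {1} {suc p} (ℕ.s≤s ℕ.z≤n) (m≤m! N)))
  where N = suc d-1
archimedes (mkℚ (ℤ.+ 0) _ _)     0<δ with ℚ.positive 0<δ
... | ()
archimedes (mkℚ ℤ.-[1+ _ ] _ _) 0<δ with ℚ.positive 0<δ
... | ()

∣∣≤ : ∀ {p q} → p ℚ.≤ q → ℚ.- p ℚ.≤ q → ∣ p ∣ ℚ.≤ q
∣∣≤ {p} p≤q -p≤q with ℚₚ.∣p∣≡p∨∣p∣≡-p p
... | inj₁ eq = subst (ℚ._≤ _) (sym eq) p≤q
... | inj₂ eq = subst (ℚ._≤ _) (sym eq) -p≤q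

abstract
  e-cauchy : Cauchy e-seq
  e-cauchy  δ 0<δ =
    let (N , 1≤N , 1/N!≤δ) = archimedes δ 0<δ
        close : ∀ m n → N ℕ.≤ m → N ℕ.≤ n → e-seq m ℚ.- e-seq n ℚ.≤ δ
        close = λ m n N≤m N≤n →
          let open ℚₚ.≤-Reasoning
          in begin
            e-seq m ℚ.- e-seq n
              ≤⟨ ℚₚ.+-mono-≤
                   (subst (ℚ._≤ e-seq m ℚ.+ 1/ m !) (ℚₚ.+-identityʳ (e-seq m))
                     (ℚₚ.+-monoʳ-≤ (e-seq m) (ℚₚ.<⇒≤ (1/-pos (m !) {{ℕₚ._!≢0 m}}))))
                   (ℚₚ.neg-antimono-≤ (e-mono (ℕₚ.≤⇒≤′ N≤n))) ⟩
            (e-seq m ℚ.+ 1/ m !) ℚ.- e-seq N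
              ≤⟨ ℚₚ.+-monoˡ-≤ (ℚ.- e-seq N) (e-tail 1≤N (ℕₚ.≤⇒≤′ N≤m)) ⟩
            (e-seq N ℚ.+ 1/ N !) ℚ.- e-seq N
              ≡⟨ solve 2 (λ a b → (a :+ b) :- a := b) refl (e-seq N) (1/ N !) ⟩
            1/ N !
              ≤⟨ 1/N!≤δ ⟩
            δ ∎
    in N , λ m n N≤m N≤n → ∣∣≤ (close m n N≤m N≤n)
      (subst (ℚ._≤ δ)
        (solve 2 (λ a b → b :- a := :- (a :- b)) refl (e-seq m) (e-seq n))
        (close n m N≤n N≤m))
    where open +-*-Solver

e : ℝ
e = mkℝ e-seq e-cauchy

0<e : 0ℝ < e
0<e = 1/ 0 ! , 1/-pos (0 !) {{ℕₚ._!≢0 0}} , 0 , λ n _ →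
  subst (ℚ._≤ e-seq n) (sym (ℚₚ.+-identityˡ (1/ 0 !))) (e-mono (ℕₚ.≤⇒≤′ {0} {n} ℕ.z≤n))

------------------------------------------------------------------------
-- Finite trees

record FiniteGraph : Set₁ where
  infix 4 _≟_ _~_
  field
    V        : Set
    _≟_      : DecidableEquality V
    vertices : List V
    unique   : Unique vertices
    complete : ∀ v → v ∈ vertices
    _~_      : V → V → Set
    ~-sym    : Symmetric _~_
    ~-irrefl : ∀ v → ¬ (v ~ v)

module _ (G : FiniteGraph) where
  open FiniteGraph G

  infixr 5 _∷_

  data Walk : V → V → Set where
    [_] : ∀ v → Walk v v
    _∷_ : ∀ {u v w} → u ~ v → Walk v w → Walk u w

module _ {G : FiniteGraph} where
  open FiniteGraph G

  visited : ∀ {u v} → Walk G u v → List V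
  visited [ v ]           = v ∷ []
  visited (_∷_ {u = u} _ p) = u ∷ visited p

  ∣_∣ʷ : ∀ {u v} → Walk G u v → ℕ
  ∣ [ _ ] ∣ʷ = 0
  ∣ _ ∷ p ∣ʷ = suc ∣ p ∣ʷ

  IsPath : ∀ {u v} → Walk G u v → Set
  IsPath p = Unique (visited p)

-- Walks are compared by their vertices, since _~_ may be proof-relevant.
IsTree : FiniteGraph → Set
IsTree G = ∀ u v → ∃! (λ p q → visited p ≡ visited q) (λ (p : Walk G u v) → IsPath p)

record Instance : Set₁ where
  field
    graph  : FiniteGraph
    isTree : IsTree graph
    s      : FiniteGraph.V graph
  open FiniteGraph graph public

module _ (I : Instance) where
  open Instance I
  open DecMembership _≟_ using (_∈?_)

  pathTo : ∀ v → Walk graph s v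
  pathTo v = proj₁ (isTree s v)

  P : V → List V
  P v = visited (pathTo v)

  -- A path is a shortest walk in a tree, so this is the distance from s.
  dist : V → ℕ
  dist v = ∣ pathTo v ∣ʷ

  L : ℕ → List V
  L j = filter (λ v → dist v ℕₚ.≟ j) vertices

  ----------------------------------------------------------------------
  -- Integral optimum

  -- U t is the vertex picked at time t ≥ 1; the value U 0 is never used.
  Strategy : Set
  Strategy = ℕ → V

  picked : Strategy → ℕ → List V
  picked U i = applyUpTo (λ t → U (suc t)) i

  Saved : Strategy → V → Set
  Saved U u = ∃[ i ] (1 ℕ.≤ toℕ i × lookup (P u) i ∈ picked U (toℕ i))

  saved? : ∀ U u → Dec (Saved U u)
  saved? U u = Finₚ.any? λ i →
    (1 ℕₚ.≤? toℕ i) ×-dec (lookup (P u) i ∈? picked U (toℕ i))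

  #saved : Strategy → ℕ
  #saved U = length (filter (saved? U) vertices)

  IsOPT : ℕ → Set
  IsOPT k = (∃[ U ] #saved U ≡ k) × (∀ U → #saved U ℕ.≤ k)

  ----------------------------------------------------------------------
  -- Canonical LP relaxation

  record Feasible (x y : V → ℝ) : Set where
    field
      layer : ∀ j → 1 ℕ.≤ j → ∑ (L j) x ≤ 1ℝ
      cover : ∀ v → y v ≤ ∑ (P v) x
      0≤x   : ∀ v → 0ℝ ≤ x v
      x≤1   : ∀ v → x v ≤ 1ℝ
      0≤y   : ∀ v → 0ℝ ≤ y v
      y≤1   : ∀ v → y v ≤ 1ℝ
      x-s   : x s ≃ 0ℝ

  IsLP : ℝ → Set
  IsLP z = (∃[ x ] ∃[ y ] (Feasible x y × ∑ vertices y ≃ z))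
         × (∀ x y → Feasible x y → ∑ vertices y ≤ z)

{-# OPTIONS --safe #-}

module Submission where

-- Call a vertex guarded if the fractional solution puts 1/k on it; every root-to-leaf path meets
-- k guarded vertices, one per level, so all leaves are fractionally saved.  A guarded vertex R
-- whose subtree is entered at time T owns a block of n = m (T + 1) consecutive layers, where
-- m = k - 1.  Its k n children on the next level lie in that block, k in each layer, and are
-- joined to R by subdivided edges that already separate at R.  Until the end of the block only
-- T + n picks have been made, so at most a fraction (T + n) / (k n) ≤ 1/m of these children is
-- cut off in time, whatever the strategy does.  By induction over the k levels at least the
-- fraction (1 - 1/m)^(m + 1) ≥ 1/e - 2/m of the leaves burns.

-- The relaxation admits only `k` guarded vertices per layer, so different guarded vertices cannot
-- share a block: the blocks follow one another, and before a late one starts the strategy has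
-- collected `T` picks. A block length proportional to `T + 1` keeps this harmless, because then m T
-- ≤ n. This is also why a level loses 1/m and not 1/k: the n picks during a block amount to 1/k of
-- the k n children, and the T earlier ones raise this to at most 1/m. The delays cost the
-- fractional solution nothing, since a leaf is credited however deep it lies. The private
-- subdivided edges let the children of R sit in different layers while no vertex below R separates
-- two of them from the root. The branches at a vertex carry equally many leaves, so none is worth
-- more than another. Inner vertices can be saved as well, but their number does not depend on the
-- number `W` of leaves; `W` is therefore chosen last and large enough to make them negligible.

open import Data.Nat.Base using (ℕ)

-- Trees built by grafting, and their unique paths

module Trees where

  open import Data.Bool.Base using (Bool)
  open import Data.Empty using (⊥-elim)
  open import Data.List.Base using (List; []; _∷_; _++_; map; length)
  open import Data.List.Membership.Propositional using (_∈_; _∉_)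
  open import Data.List.Membership.Propositional.Properties
    using (∈-map⁺; ∈-map⁻; ∈-++⁺ˡ; ∈-++⁺ʳ)
  open import Data.List.Properties using (length-map)
  open import Data.List.Relation.Unary.All as All using (All; []; _∷_)
  open import Data.List.Relation.Unary.All.Properties using (All¬⇒¬Any; ++⁻ˡ)
  open import Data.List.Relation.Unary.AllPairs using ([]; _∷_)
  open import Data.List.Relation.Unary.Any using (here; there)
  open import Data.List.Relation.Unary.Unique.Propositional using (Unique)
  open import Data.List.Relation.Unary.Unique.Propositional.Properties using (map⁺; map⁻; ++⁺)
  open import Data.Nat.Base using (ℕ; suc)
  open import Data.Nat.Properties using (suc-injective)
  open import Data.Product.Base using (_×_; _,_; proj₂; ∃-syntax; Σ-syntax)
  open import Data.Sum.Base using (_⊎_; inj₁; inj₂)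
  open import Function.Base using (_∘_)
  open import Relation.Binary.Definitions using (DecidableEquality)
  open import Relation.Binary.PropositionalEquality
  open import Relation.Nullary using (¬_; yes; no)
  open import Relation.Nullary.Decidable using (map′)
  open import Defs using (FiniteGraph; Walk; [_]; _∷_; visited; ∣_∣ʷ; IsPath; IsTree; Instance; dist)
    renaming (P to rootPath)

  -- `inner true` marks the vertices on which the fractional solution is positive.
  data Label : Set where
    leaf  : Label
    inner : Bool → Label

  infixl 5 _⊕_

  -- A ⊕ B attaches the root of B as a new child of the root of A.
  data Tree : Set where
    ∙   : Label → Tree
    _⊕_ : Tree → Tree → Tree

  data Vertex : Tree → Set where
    ⋆   : ∀ {l} → Vertex (∙ l)
    inl : ∀ {A B} → Vertex A → Vertex (A ⊕ B)
    inr : ∀ {A B} → Vertex B → Vertex (A ⊕ B)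

  root : ∀ t → Vertex t
  root (∙ _)   = ⋆
  root (A ⊕ _) = inl (root A)

  label : ∀ {t} → Vertex t → Label
  label {∙ l} ⋆ = l
  label (inl v) = label v
  label (inr v) = label v

  depth : ∀ {t} → Vertex t → ℕ
  depth ⋆       = 0
  depth (inl v) = depth v
  depth (inr v) = suc (depth v)

  depth-root : ∀ t → depth (root t) ≡ 0
  depth-root (∙ _)   = refl
  depth-root (A ⊕ _) = depth-root A

  path : ∀ {t} → Vertex t → List (Vertex t)
  path ⋆                   = ⋆ ∷ []
  path (inl v)             = map inl (path v)
  path {A ⊕ _} (inr v)     = inl (root A) ∷ map inr (path v)

  vertices : ∀ t → List (Vertex t)
  vertices (∙ _)   = ⋆ ∷ []
  vertices (A ⊕ B) = map inl (vertices A) ++ map inr (vertices B)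

  infix 4 _∼_

  data _∼_ : ∀ {t} → Vertex t → Vertex t → Set where
    left  : ∀ {A B} {u v : Vertex A} → u ∼ v → inl {B = B} u ∼ inl v
    right : ∀ {A B} {u v : Vertex B} → u ∼ v → inr {A = A} u ∼ inr v
    down  : ∀ {A B} → inl {A} {B} (root A) ∼ inr (root B)
    up    : ∀ {A B} → inr {A} {B} (root B) ∼ inl (root A)

  inl-injective : ∀ {A B} {u v : Vertex A} → inl {B = B} u ≡ inl v → u ≡ v
  inl-injective refl = refl

  inr-injective : ∀ {A B} {u v : Vertex B} → inr {A = A} u ≡ inr v → u ≡ v
  inr-injective refl = refl

  _≟ᵛ_ : ∀ {t} → DecidableEquality (Vertex t)
  ⋆     ≟ᵛ ⋆     = yes refl
  inl u ≟ᵛ inl v = map′ (cong inl) inl-injective (u ≟ᵛ v)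
  inr u ≟ᵛ inr v = map′ (cong inr) inr-injective (u ≟ᵛ v)
  inl _ ≟ᵛ inr _ = no λ ()
  inr _ ≟ᵛ inl _ = no λ ()

  inl-inr-unique : ∀ {A B} {us : List (Vertex A)} {vs : List (Vertex B)} →
                   Unique us → Unique vs → Unique (map (inl {A} {B}) us ++ map inr vs)
  inl-inr-unique us! vs! = ++⁺ (map⁺ inl-injective us!) (map⁺ inr-injective vs!) disjoint
    where
    disjoint : ∀ {v} → ¬ (v ∈ map inl _ × v ∈ map inr _)
    disjoint (p , q) with ∈-map⁻ inl p | ∈-map⁻ inr q
    ... | _ , _ , refl | _ , _ , ()

  inr-inl-unique : ∀ {A B} {us : List (Vertex A)} {vs : List (Vertex B)} →
                   Unique us → Unique vs → Unique (map (inr {A} {B}) vs ++ map inl us)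
  inr-inl-unique us! vs! = ++⁺ (map⁺ inr-injective vs!) (map⁺ inl-injective us!) disjoint
    where
    disjoint : ∀ {v} → ¬ (v ∈ map inr _ × v ∈ map inl _)
    disjoint (p , q) with ∈-map⁻ inr p | ∈-map⁻ inl q
    ... | _ , _ , refl | _ , _ , ()

  vertices-unique : ∀ t → Unique (vertices t)
  vertices-unique (∙ _)   = [] ∷ []
  vertices-unique (A ⊕ B) = inl-inr-unique (vertices-unique A) (vertices-unique B)

  ∈-vertices : ∀ {t} (v : Vertex t) → v ∈ vertices t
  ∈-vertices ⋆       = here refl
  ∈-vertices (inl v) = ∈-++⁺ˡ (∈-map⁺ inl (∈-vertices v))
  ∈-vertices {A ⊕ _} (inr v) = ∈-++⁺ʳ (map inl (vertices A)) (∈-map⁺ inr (∈-vertices v))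

  ∼-sym : ∀ {t} {u v : Vertex t} → u ∼ v → v ∼ u
  ∼-sym (left e)  = left (∼-sym e)
  ∼-sym (right e) = right (∼-sym e)
  ∼-sym down      = up
  ∼-sym up        = down

  ∼-irrefl : ∀ {t} (v : Vertex t) → ¬ (v ∼ v)
  ∼-irrefl (inl v) (left e)  = ∼-irrefl v e
  ∼-irrefl (inr v) (right e) = ∼-irrefl v e

  graph : Tree → FiniteGraph
  graph t = record
    { V        = Vertex t
    ; _≟_      = _≟ᵛ_
    ; vertices = vertices t
    ; unique   = vertices-unique t
    ; complete = ∈-vertices
    ; _~_      = _∼_
    ; ~-sym    = ∼-sym
    ; ~-irrefl = ∼-irrefl
    }

  -- The candidate for the unique path. The edge between the two roots is the only link between the
  -- halves of `A ⊕ B`, so it is crossed exactly when the endpoints lie on different sides.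
  route : ∀ {t} (u v : Vertex t) → List (Vertex t)
  route ⋆ ⋆ = ⋆ ∷ []
  route (inl u) (inl v) = map inl (route u v)
  route (inr u) (inr v) = map inr (route u v)
  route {A ⊕ B} (inl u) (inr v) = map inl (route u (root A)) ++ map inr (route (root B) v)
  route {A ⊕ B} (inr u) (inl v) = map inr (route u (root B)) ++ map inl (route (root A) v)

  route-unique : ∀ {t} (u v : Vertex t) → Unique (route u v)
  route-unique ⋆ ⋆ = [] ∷ []
  route-unique (inl u) (inl v) = map⁺ inl-injective (route-unique u v)
  route-unique (inr u) (inr v) = map⁺ inr-injective (route-unique u v)
  route-unique {A ⊕ B} (inl u) (inr v) = inl-inr-unique (route-unique u (root A)) (route-unique (root B) v)
  route-unique {A ⊕ B} (inr u) (inl v) = inr-inl-unique (route-unique (root A) v) (route-unique u (root B))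

  Walkᵗ : ∀ {t} → Vertex t → Vertex t → Set
  Walkᵗ {t} = Walk (graph t)

  module _ {A B : Tree} where

    mapˡ : {u v : Vertex A} (p : Walkᵗ u v) →
           Σ[ q ∈ Walkᵗ {A ⊕ B} (inl u) (inl v) ] visited q ≡ map inl (visited p)
    mapˡ [ v ]   = [ inl v ] , refl
    mapˡ (e ∷ p) = let (q , eq) = mapˡ p in left e ∷ q , cong (_ ∷_) eq

    mapʳ : {u v : Vertex B} (p : Walkᵗ u v) →
           Σ[ q ∈ Walkᵗ {A ⊕ B} (inr u) (inr v) ] visited q ≡ map inr (visited p)
    mapʳ [ v ]   = [ inr v ] , refl
    mapʳ (e ∷ p) = let (q , eq) = mapʳ p in right e ∷ q , cong (_ ∷_) eq

    descend : ∀ {u w} (p : Walkᵗ u (root A)) (q : Walkᵗ {A ⊕ B} (inr (root B)) w) →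
              Σ[ r ∈ Walkᵗ (inl u) w ] visited r ≡ map inl (visited p) ++ visited q
    descend [ _ ]   q = down ∷ q , refl
    descend (e ∷ p) q = let (r , eq) = descend p q in left e ∷ r , cong (_ ∷_) eq

    ascend : ∀ {u w} (p : Walkᵗ u (root B)) (q : Walkᵗ {A ⊕ B} (inl (root A)) w) →
             Σ[ r ∈ Walkᵗ (inr u) w ] visited r ≡ map inr (visited p) ++ visited q
    ascend [ _ ]   q = up ∷ q , refl
    ascend (e ∷ p) q = let (r , eq) = ascend p q in right e ∷ r , cong (_ ∷_) eq

  walk : ∀ {t} (u v : Vertex t) → Σ[ p ∈ Walkᵗ u v ] visited p ≡ route u v
  walk ⋆ ⋆ = [ ⋆ ] , refl
  walk (inl u) (inl v) =
    let (p , p≡) = walk u v; (q , q≡) = mapˡ p in q , trans q≡ (cong (map inl) p≡)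
  walk (inr u) (inr v) =
    let (p , p≡) = walk u v; (q , q≡) = mapʳ p in q , trans q≡ (cong (map inr) p≡)
  walk {A ⊕ B} (inl u) (inr v) =
    let (p , p≡) = walk u (root A); (q , q≡) = walk (root B) v
        (q′ , q′≡) = mapʳ q; (r , r≡) = descend p q′
    in r , trans r≡ (cong₂ _++_ (cong (map inl) p≡) (trans q′≡ (cong (map inr) q≡)))
  walk {A ⊕ B} (inr u) (inl v) =
    let (p , p≡) = walk u (root B); (q , q≡) = walk (root A) v
        (q′ , q′≡) = mapˡ q; (r , r≡) = ascend p q′
    in r , trans r≡ (cong₂ _++_ (cong (map inr) p≡) (trans q′≡ (cong (map inl) q≡)))

  start∈ : ∀ {t} {u v : Vertex t} (p : Walkᵗ u v) → u ∈ visited p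
  start∈ [ _ ]   = here refl
  start∈ (_ ∷ _) = here refl

  unique-++ˡ : ∀ {X : Set} (xs : List X) {ys} → Unique (xs ++ ys) → Unique xs
  unique-++ˡ []       _          = []
  unique-++ˡ (x ∷ xs) (x∉ ∷ u)   = ++⁻ˡ xs x∉ ∷ unique-++ˡ xs u

  unique-++ʳ : ∀ {X : Set} (xs : List X) {ys} → Unique (xs ++ ys) → Unique ys
  unique-++ʳ []       u       = u
  unique-++ʳ (_ ∷ xs) (_ ∷ u) = unique-++ʳ xs u

  module _ {A B : Tree} where

    -- Having used the edge between the two roots, a path cannot use it again.
    stayˡ : ∀ {u w} (p : Walkᵗ {A ⊕ B} (inl u) w) → inr (root B) ∉ visited p →
            ∃[ v ] w ≡ inl v × Σ[ q ∈ Walkᵗ u v ] visited p ≡ map inl (visited q)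
    stayˡ [ _ ] _ = _ , refl , [ _ ] , refl
    stayˡ (left e ∷ p) ∉p =
      let (v , w≡ , q , eq) = stayˡ p (∉p ∘ there) in v , w≡ , e ∷ q , cong (_ ∷_) eq
    stayˡ (down ∷ p) ∉p = ⊥-elim (∉p (there (start∈ p)))

    stayʳ : ∀ {u w} (p : Walkᵗ {A ⊕ B} (inr u) w) → inl (root A) ∉ visited p →
            ∃[ v ] w ≡ inr v × Σ[ q ∈ Walkᵗ u v ] visited p ≡ map inr (visited q)
    stayʳ [ _ ] _ = _ , refl , [ _ ] , refl
    stayʳ (right e ∷ p) ∉p =
      let (v , w≡ , q , eq) = stayʳ p (∉p ∘ there) in v , w≡ , e ∷ q , cong (_ ∷_) eq
    stayʳ (up ∷ p) ∉p = ⊥-elim (∉p (there (start∈ p)))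

    splitˡ : ∀ {u w} (p : Walkᵗ {A ⊕ B} (inl u) w) → IsPath p →
             (∃[ v ] w ≡ inl v × Σ[ q ∈ Walkᵗ u v ] visited p ≡ map inl (visited q)) ⊎
             (∃[ v ] w ≡ inr v × Σ[ q ∈ Walkᵗ u (root A) ] Σ[ r ∈ Walkᵗ (root B) v ]
               visited p ≡ map inl (visited q) ++ map inr (visited r))
    splitˡ [ _ ] _ = inj₁ (_ , refl , [ _ ] , refl)
    splitˡ (left e ∷ p) (_ ∷ p!) with splitˡ p p!
    ... | inj₁ (v , w≡ , q , eq)     = inj₁ (v , w≡ , e ∷ q , cong (_ ∷_) eq)
    ... | inj₂ (v , w≡ , q , r , eq) = inj₂ (v , w≡ , e ∷ q , r , cong (_ ∷_) eq)
    splitˡ (down ∷ p) (∉p ∷ _) =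
      let (v , w≡ , r , eq) = stayʳ p (All¬⇒¬Any ∉p)
      in inj₂ (v , w≡ , [ _ ] , r , cong (_ ∷_) eq)

    splitʳ : ∀ {u w} (p : Walkᵗ {A ⊕ B} (inr u) w) → IsPath p →
             (∃[ v ] w ≡ inr v × Σ[ q ∈ Walkᵗ u v ] visited p ≡ map inr (visited q)) ⊎
             (∃[ v ] w ≡ inl v × Σ[ q ∈ Walkᵗ u (root B) ] Σ[ r ∈ Walkᵗ (root A) v ]
               visited p ≡ map inr (visited q) ++ map inl (visited r))
    splitʳ [ _ ] _ = inj₁ (_ , refl , [ _ ] , refl)
    splitʳ (right e ∷ p) (_ ∷ p!) with splitʳ p p!
    ... | inj₁ (v , w≡ , q , eq)     = inj₁ (v , w≡ , e ∷ q , cong (_ ∷_) eq)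
    ... | inj₂ (v , w≡ , q , r , eq) = inj₂ (v , w≡ , e ∷ q , r , cong (_ ∷_) eq)
    splitʳ (up ∷ p) (∉p ∷ _) =
      let (v , w≡ , r , eq) = stayˡ p (All¬⇒¬Any ∉p)
      in inj₂ (v , w≡ , [ _ ] , r , cong (_ ∷_) eq)

  -- Both pieces of a path split at the edge between the roots again have distinct vertices, so
  -- induction on the tree applies to each of them.
  path-is-route : ∀ {t} {u v : Vertex t} (p : Walkᵗ u v) → IsPath p → visited p ≡ route u v
  path-is-route {∙ _} {⋆} {⋆} [ ⋆ ] _ = refl
  path-is-route {∙ _} (() ∷ _)
  path-is-route {A ⊕ B} {inl u} p p! with splitˡ p p!
  ... | inj₁ (_ , refl , q , eq) = trans eq (cong (map inl)
          (path-is-route q (map⁻ (subst Unique eq p!))))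
  ... | inj₂ (_ , refl , q , r , eq) = trans eq (cong₂ _++_
          (cong (map inl) (path-is-route q (map⁻ (unique-++ˡ _ (subst Unique eq p!)))))
          (cong (map inr) (path-is-route r (map⁻ (unique-++ʳ (map inl (visited q)) (subst Unique eq p!))))))
  path-is-route {A ⊕ B} {inr u} p p! with splitʳ p p!
  ... | inj₁ (_ , refl , q , eq) = trans eq (cong (map inr)
          (path-is-route q (map⁻ (subst Unique eq p!))))
  ... | inj₂ (_ , refl , q , r , eq) = trans eq (cong₂ _++_
          (cong (map inr) (path-is-route q (map⁻ (unique-++ˡ _ (subst Unique eq p!)))))
          (cong (map inl) (path-is-route r (map⁻ (unique-++ʳ (map inr (visited q)) (subst Unique eq p!))))))

  graph-isTree : ∀ t → IsTree (graph t)
  graph-isTree t u v =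
    let (p , eq) = walk u v
    in p , subst Unique (sym eq) (route-unique u v) , λ {q} q! → trans eq (sym (path-is-route q q!))

  firefighter : Tree → Instance
  firefighter t = record { graph = graph t ; isTree = graph-isTree t ; s = root t }

  route-root : ∀ {t} (v : Vertex t) → route (root t) v ≡ path v
  route-root ⋆       = refl
  route-root (inl v) = cong (map inl) (route-root v)
  route-root {A ⊕ B} (inr v) = cong₂ _++_ (cong (map inl) (root-path A)) (cong (map inr) (route-root v))
    where
    root-path : ∀ t → route (root t) (root t) ≡ root t ∷ []
    root-path (∙ _)   = refl
    root-path (A ⊕ _) = cong (map inl) (root-path A)

  rootPath-path : ∀ {t} (v : Vertex t) → rootPath (firefighter t) v ≡ path v
  rootPath-path {t} v = trans (proj₂ (walk (root t) v)) (route-root v)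

  length-path : ∀ {t} (v : Vertex t) → length (path v) ≡ suc (depth v)
  length-path ⋆       = refl
  length-path (inl v) = trans (length-map inl (path v)) (length-path v)
  length-path (inr v) = cong suc (trans (length-map inr (path v)) (length-path v))

  dist-depth : ∀ {t} (v : Vertex t) → dist (firefighter t) v ≡ depth v
  dist-depth {t} v = suc-injective (trans (length-visited _)
    (trans (cong length (rootPath-path v)) (length-path v)))
    where
    length-visited : ∀ {u v : Vertex t} (p : Walkᵗ u v) → suc ∣ p ∣ʷ ≡ length (visited p)
    length-visited [ _ ]   = refl
    length-visited (_ ∷ p) = cong suc (length-visited p)

-- Weights, leaves and picks, computed by recursion on the tree

module Combinatorics where

  open import Algebra.Properties.CommutativeSemigroup using (interchange)
  open import Data.Bool.Base using (Bool; true; false; if_then_else_)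
  open import Data.List.Membership.Propositional using (_∈_)
  open import Data.List.Membership.Propositional.Properties using (∈-map⁻)
  open import Data.List.Relation.Unary.Any using (here; there)
  open import Data.Maybe.Base using (Maybe; just; nothing; _>>=_)
  open import Data.Nat.Base
  open import Data.Nat.Divisibility using (_∣_; ∣-trans; n∣m*n; m∣m*n)
  open import Data.Nat.Properties
  open import Data.Nat.Tactic.RingSolver using (solve-∀)
  open import Data.Product.Base using (_×_; _,_; ∃-syntax; Σ-syntax)
  open import Data.Sum.Base using (inj₁; inj₂)
  open import Function.Base using (_∘_)
  open import Relation.Binary.PropositionalEquality
  open import Relation.Nullary using (yes; no)
  open Trees

  Σ : (ℕ → ℕ) → ℕ → ℕ
  Σ g zero    = 0
  Σ g (suc n) = Σ g n + g n

  Σ-zero : ∀ {g} n → (∀ j → j < n → g j ≡ 0) → Σ g n ≡ 0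
  Σ-zero zero    g≡0 = refl
  Σ-zero (suc n) g≡0 = cong₂ _+_ (Σ-zero n (λ j j<n → g≡0 j (m<n⇒m<1+n j<n))) (g≡0 n (n<1+n n))

  Σ-const : ∀ {g c} n → (∀ j → j < n → g j ≡ c) → Σ g n ≡ n * c
  Σ-const         zero    g≡c = refl
  Σ-const {c = c} (suc n) g≡c = trans
    (cong₂ _+_ (Σ-const n (λ j j<n → g≡c j (m<n⇒m<1+n j<n))) (g≡c n (n<1+n n)))
    (+-comm (n * c) c)

  Σ-cong : ∀ {f g} n → (∀ j → f j ≡ g j) → Σ f n ≡ Σ g n
  Σ-cong zero    f≡g = refl
  Σ-cong (suc n) f≡g = cong₂ _+_ (Σ-cong n f≡g) (f≡g n)

  Σ-mono : ∀ {f g} n → (∀ j → f j ≤ g j) → Σ f n ≤ Σ g n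
  Σ-mono zero    f≤g = z≤n
  Σ-mono (suc n) f≤g = +-mono-≤ (Σ-mono n f≤g) (f≤g n)

  Σ-+ : ∀ f g n → Σ (λ j → f j + g j) n ≡ Σ f n + Σ g n
  Σ-+ f g zero    = refl
  Σ-+ f g (suc n) = trans (cong (_+ (f n + g n)) (Σ-+ f g n))
    (interchange +-commutativeSemigroup (Σ f n) (Σ g n) (f n) (g n))

  Σ≡0⇒≡0 : ∀ {g} n → Σ g n ≡ 0 → ∀ j → j < n → g j ≡ 0
  Σ≡0⇒≡0 {g} (suc n) eq j (s≤s j≤n) with m≤n⇒m<n∨m≡n j≤n
  ... | inj₁ j<n  = Σ≡0⇒≡0 n (m+n≡0⇒m≡0 (Σ g n) eq) j j<n
  ... | inj₂ refl = m+n≡0⇒n≡0 (Σ g n) eq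

  -- Used for a layer inside a block, where the contributing branches form a window of `k`
  -- consecutive indices.
  Σ-window : ∀ {g} n lo k → (∀ j → j < n → g j ≤ 1) →
             (∀ j → j < n → j < lo → g j ≡ 0) →
             (∀ j → j < n → lo + k ≤ j → g j ≡ 0) → Σ g n ≤ k
  Σ-window {g} n lo k g≤1 below above = go n (λ j j<n → j<n)
    where
    from-lo : ∀ i → (∀ j → j < i → j < n) → Σ g i ≤ i ∸ lo
    from-lo zero    i≤n = z≤n
    from-lo (suc i) i≤n with i <? lo
    ... | yes i<lo = begin
        Σ g i + g i   ≡⟨ cong (Σ g i +_) (below i (i≤n i ≤-refl) i<lo) ⟩
        Σ g i + 0     ≡⟨ +-identityʳ _ ⟩
        Σ g i         ≤⟨ from-lo i (λ j j<i → i≤n j (m<n⇒m<1+n j<i)) ⟩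
        i ∸ lo        ≤⟨ ∸-monoˡ-≤ lo (n≤1+n i) ⟩
        suc i ∸ lo    ∎
      where open ≤-Reasoning
    ... | no i≮lo = begin
        Σ g i + g i   ≤⟨ +-mono-≤ (from-lo i (λ j j<i → i≤n j (m<n⇒m<1+n j<i))) (g≤1 i (i≤n i ≤-refl)) ⟩
        i ∸ lo + 1    ≡⟨ +-comm (i ∸ lo) 1 ⟩
        1 + (i ∸ lo)  ≡⟨ +-∸-assoc 1 (≮⇒≥ i≮lo) ⟨
        suc i ∸ lo    ∎
      where open ≤-Reasoning

    go : ∀ i → (∀ j → j < i → j < n) → Σ g i ≤ k
    go zero    i≤n = z≤n
    go (suc i) i≤n with lo + k ≤? i
    ... | yes lo+k≤i = begin
        Σ g i + g i   ≡⟨ cong (Σ g i +_) (above i (i≤n i ≤-refl) lo+k≤i) ⟩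
        Σ g i + 0     ≡⟨ +-identityʳ _ ⟩
        Σ g i         ≤⟨ go i (λ j j<i → i≤n j (m<n⇒m<1+n j<i)) ⟩
        k             ∎
      where open ≤-Reasoning
    ... | no lo+k≰i = ≤-trans (from-lo (suc i) i≤n) (m≤n+o⇒m∸n≤o (suc i) lo (≰⇒> lo+k≰i))

  -- Used for a layer below a block: the intervals from `s j` (excluded) to `s (suc j)` are
  -- disjoint, so `D` lies in at most one and a single summand survives.
  Σ-intervals : ∀ {g k D} (s : ℕ → ℕ) → (∀ {i j} → i ≤ j → s i ≤ s j) → ∀ n →
                (∀ j → j < n → g j ≤ k) →
                (∀ j → j < n → D ≤ s j → g j ≡ 0) →
                (∀ j → j < n → s (suc j) < D → g j ≡ 0) → Σ g n ≤ k
  Σ-intervals s s-mono zero g≤k before after = z≤n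
  Σ-intervals {g} {k} {D} s s-mono (suc n) g≤k before after with D ≤? s n
  ... | yes D≤sn = begin
      Σ g n + g n   ≡⟨ cong (Σ g n +_) (before n ≤-refl D≤sn) ⟩
      Σ g n + 0     ≡⟨ +-identityʳ _ ⟩
      Σ g n         ≤⟨ Σ-intervals s s-mono n (λ j j<n → g≤k j (m<n⇒m<1+n j<n))
                         (λ j j<n → before j (m<n⇒m<1+n j<n)) (λ j j<n → after j (m<n⇒m<1+n j<n)) ⟩
      k             ∎
    where open ≤-Reasoning
  ... | no D≰sn = begin
      Σ g n + g n   ≡⟨ cong (_+ g n) (Σ-zero n λ j j<n →
                         after j (m<n⇒m<1+n j<n) (≤-<-trans (s-mono j<n) (≰⇒> D≰sn))) ⟩
      g n           ≤⟨ g≤k n ≤-refl ⟩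
      k             ∎
    where open ≤-Reasoning

  Π : (ℕ → ℕ) → ℕ → ℕ
  Π g zero    = 1
  Π g (suc n) = Π g n * g n

  ∣Π : ∀ g {j} n → j < n → g j ∣ Π g n
  ∣Π g (suc n) (s≤s j≤n) with m≤n⇒m<n∨m≡n j≤n
  ... | inj₁ j<n  = ∣-trans (∣Π g n j<n) (m∣m*n (g n))
  ... | inj₂ refl = n∣m*n (Π g n)

  Π-positive : ∀ {g} n → (∀ j → 0 < g j) → 0 < Π g n
  Π-positive zero    g>0 = s≤s z≤n
  Π-positive (suc n) g>0 = *-mono-≤ (Π-positive n g>0) (g>0 n)

  weight : Label → ℕ
  weight (inner true) = 1
  weight _            = 0

  weight≤1 : ∀ l → weight l ≤ 1
  weight≤1 leaf          = z≤n
  weight≤1 (inner true)  = ≤-refl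
  weight≤1 (inner false) = z≤n

  layerWeight : Tree → ℕ → ℕ
  layerWeight (∙ l)   zero    = weight l
  layerWeight (∙ l)   (suc d) = 0
  layerWeight (A ⊕ B) zero    = layerWeight A zero
  layerWeight (A ⊕ B) (suc d) = layerWeight A (suc d) + layerWeight B d

  pathWeight : ∀ {t} → Vertex t → ℕ
  pathWeight {∙ l}   ⋆       = weight l
  pathWeight         (inl v) = pathWeight v
  pathWeight {A ⊕ _} (inr v) = weight (label (root A)) + pathWeight v

  leaves : Tree → ℕ
  leaves (∙ leaf)      = 1
  leaves (∙ (inner _)) = 0
  leaves (A ⊕ B)       = leaves A + leaves B

  inners : Tree → ℕ
  inners (∙ leaf)      = 0
  inners (∙ (inner _)) = 1
  inners (A ⊕ B)       = inners A + inners B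

  -- Here a vertex is marked when `Q` holds, whatever the flag of `inner` says. Inner vertices count
  -- too, so that marked and unmarked vertices exhaust the tree.
  unmarked : ∀ t → (Vertex t → Bool) → ℕ
  unmarked (∙ _)   Q = if Q ⋆ then 0 else 1
  unmarked (A ⊕ B) Q = unmarked A (Q ∘ inl) + unmarked B (Q ∘ inr)

  children : Bool → ℕ → (ℕ → Tree) → Tree
  children b zero    f = ∙ (inner b)
  children b (suc n) f = children b n f ⊕ f n

  chain : ℕ → Tree → Tree
  chain zero    t = t
  chain (suc c) t = ∙ (inner false) ⊕ chain c t

  label-root-children : ∀ b n f → label (root (children b n f)) ≡ inner b
  label-root-children b zero    f = refl
  label-root-children b (suc n) f = label-root-children b n f

  layerWeight-root : ∀ b n f → layerWeight (children b n f) 0 ≡ weight (inner b)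
  layerWeight-root b zero    f = refl
  layerWeight-root b (suc n) f = layerWeight-root b n f

  layerWeight-children : ∀ b n f d →
    layerWeight (children b n f) (suc d) ≡ Σ (λ j → layerWeight (f j) d) n
  layerWeight-children b zero    f d = refl
  layerWeight-children b (suc n) f d = cong (_+ layerWeight (f n) d) (layerWeight-children b n f d)

  layerWeight-chain-< : ∀ c {t d} → d < c → layerWeight (chain c t) d ≡ 0
  layerWeight-chain-< (suc c) {d = zero}  _         = refl
  layerWeight-chain-< (suc c) {d = suc d} (s≤s d<c) = layerWeight-chain-< c d<c

  layerWeight-chain-+ : ∀ c t d → layerWeight (chain c t) (c + d) ≡ layerWeight t d
  layerWeight-chain-+ zero    t d = refl
  layerWeight-chain-+ (suc c) t d = layerWeight-chain-+ c t d

  leaves-children : ∀ b n f → leaves (children b n f) ≡ Σ (leaves ∘ f) n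
  leaves-children b zero    f = refl
  leaves-children b (suc n) f = cong (_+ leaves (f n)) (leaves-children b n f)

  inners-children : ∀ b n f → inners (children b n f) ≡ suc (Σ (inners ∘ f) n)
  inners-children b zero    f = refl
  inners-children b (suc n) f = cong (_+ inners (f n)) (inners-children b n f)

  leaves-chain : ∀ c t → leaves (chain c t) ≡ leaves t
  leaves-chain zero    t = refl
  leaves-chain (suc c) t = leaves-chain c t

  inners-chain : ∀ c t → inners (chain c t) ≡ c + inners t
  inners-chain zero    t = refl
  inners-chain (suc c) t = cong suc (inners-chain c t)

  LeafWeight : Tree → ℕ → Set
  LeafWeight t c = ∀ (v : Vertex t) → label v ≡ leaf → pathWeight v ≡ c

  leafWeight-children : ∀ b n {f c} → (∀ j → LeafWeight (f j) c) →
                        LeafWeight (children b n f) (weight (inner b) + c)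
  leafWeight-children b zero    h ⋆       ()
  leafWeight-children b (suc n) h (inl v) eq = leafWeight-children b n h v eq
  leafWeight-children b (suc n) {f} h (inr v) eq =
    cong₂ _+_ (cong weight (label-root-children b n f)) (h n v eq)

  leafWeight-chain : ∀ c {t w} → LeafWeight t w → LeafWeight (chain c t) w
  leafWeight-chain zero    h v       eq = h v eq
  leafWeight-chain (suc c) h (inl ⋆) ()
  leafWeight-chain (suc c) h (inr v) eq = leafWeight-chain c h v eq

  -- A pick X i happens at time i + 1.
  Picks : Tree → Set
  Picks t = ℕ → Maybe (Vertex t)

  used : {A : Set} → Maybe A → ℕ
  used (just _) = 1
  used nothing  = 0

  budget : ∀ {t} → Picks t → ℕ → ℕ
  budget X = Σ (used ∘ X)

  -- In terms of time: no pick inside `t` up to and including time `b`. If `b` is the depth of the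
  -- root of `t`, the fire gets there before anything in `t` is picked.
  Quiet : ∀ {t} → ℕ → Picks t → Set
  Quiet b X = ∀ i → i < b → X i ≡ nothing

  -- The root of t lies at depth τ of the whole tree.
  Sound : ∀ {t} → ℕ → Picks t → (Vertex t → Bool) → Set
  Sound τ X Q = ∀ v → Q v ≡ true →
    ∃[ i ] ∃[ u ] (X i ≡ just u × u ∈ path v × i < τ + depth u)

  budget-≤ : ∀ {t} (X : Picks t) b → budget X b ≤ b
  budget-≤ X b = ≤-trans (Σ-mono b (λ i → used≤1 (X i)))
    (≤-reflexive (trans (Σ-const b (λ _ _ → refl)) (*-identityʳ b)))
    where
    used≤1 : {A : Set} (x : Maybe A) → used x ≤ 1
    used≤1 (just _) = ≤-refl
    used≤1 nothing  = z≤n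

  quiet-budget : ∀ {t} {X : Picks t} τ → Quiet τ X → budget X (suc τ) ≤ 1
  quiet-budget {X = X} τ quiet
    rewrite Σ-zero τ (λ i i<τ → cong used (quiet i i<τ)) with X τ
  ... | just _  = ≤-refl
  ... | nothing = z≤n

  budget-quiet : ∀ {t} {X : Picks t} b → budget X b ≡ 0 → Quiet b X
  budget-quiet {X = X} b eq i i<b with X i | Σ≡0⇒≡0 b eq i i<b
  ... | nothing | _ = refl

  module _ {A B : Tree} where

    fromˡ : Vertex (A ⊕ B) → Maybe (Vertex A)
    fromˡ (inl v) = just v
    fromˡ (inr _) = nothing

    fromʳ : Vertex (A ⊕ B) → Maybe (Vertex B)
    fromʳ (inl _) = nothing
    fromʳ (inr v) = just v

    leftPicks : Picks (A ⊕ B) → Picks A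
    leftPicks X i = X i >>= fromˡ

    rightPicks : Picks (A ⊕ B) → Picks B
    rightPicks X i = X i >>= fromʳ

    budget-split : ∀ X b → budget (leftPicks X) b + budget (rightPicks X) b ≤ budget X b
    budget-split X b = ≤-trans
      (≤-reflexive (sym (Σ-+ (used ∘ leftPicks X) (used ∘ rightPicks X) b)))
      (Σ-mono b (λ i → split (X i)))
      where
      split : ∀ x → used (x >>= fromˡ) + used (x >>= fromʳ) ≤ used x
      split (just (inl _)) = ≤-refl
      split (just (inr _)) = ≤-refl
      split nothing        = ≤-refl

    quietˡ : ∀ {b X} → Quiet b X → Quiet b (leftPicks X)
    quietˡ quiet i i<b = cong (_>>= fromˡ) (quiet i i<b)

    quietʳ : ∀ {b X} → Quiet b X → Quiet b (rightPicks X)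
    quietʳ quiet i i<b = cong (_>>= fromʳ) (quiet i i<b)

    soundˡ : ∀ {τ X Q} → Sound τ X Q → Sound τ (leftPicks X) (Q ∘ inl)
    soundˡ sound v Qv with sound (inl v) Qv
    ... | i , u , Xi , u∈ , i< with ∈-map⁻ inl u∈
    ... | u′ , u′∈ , refl = i , u′ , cong (_>>= fromˡ) Xi , u′∈ , i<

    -- A witness at `root A` would have been picked by time `τ`, which quietness excludes. The
    -- witness thus lies in `B`, whose root is one layer deeper.
    soundʳ : ∀ {τ X Q} → Quiet τ X → Sound τ X Q → Sound (suc τ) (rightPicks X) (Q ∘ inr)
    soundʳ {τ} quiet sound v Qv with sound (inr v) Qv
    ... | i , _ , Xi , here refl , i<
        with trans (sym Xi) (quiet i (subst (i <_) (trans (cong (τ +_) (depth-root A)) (+-identityʳ τ)) i<))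
    ... | ()
    soundʳ {τ} quiet sound v Qv
      | i , u , Xi , there u∈ , i< with ∈-map⁻ inr u∈
    ... | u′ , u′∈ , refl =
          i , u′ , cong (_>>= fromʳ) Xi , u′∈ , subst (i <_) (+-suc τ (depth u′)) i<

  -- A branch in which something is picked before time b uses up a unit of the budget.
  unmarked-children : ∀ b {K w τ} g n {f} →
    (∀ j → j < n → ∀ X Q → Quiet b X → Sound (suc τ) X Q →
       w ≤ K * (unmarked (f j) Q + inners (f j))) →
    ∀ X Q → Quiet τ X → Sound τ X Q →
    n * w + K ≤ K * (unmarked (children g n f) Q + inners (children g n f)) + budget X b * w
  -- The centre is itself an inner vertex; its unit in `inners` yields the summand `K` on the left.
  unmarked-children b {K} {w} g zero h X Q quiet sound = begin
    K                            ≡⟨ *-identityʳ K ⟨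
    K * 1                        ≤⟨ *-monoʳ-≤ K (m≤n+m 1 (unmarked (∙ (inner g)) Q)) ⟩
    K * (_ + 1)                  ≤⟨ m≤m+n _ _ ⟩
    K * (_ + 1) + budget X b * w ∎
    where open ≤-Reasoning
  unmarked-children b {K} {w} {τ} g (suc n) {f} h X Q quiet sound = begin
    w + n * w + K
      ≡⟨ +-assoc w (n * w) K ⟩
    w + (n * w + K)
      ≤⟨ +-mono-≤ last (unmarked-children b g n (λ j j<n → h j (m<n⇒m<1+n j<n)) X₁ (Q ∘ inl)
           (quietˡ quiet) (soundˡ sound)) ⟩
    K * (u₂ + i₂) + b₂ * w + (K * (u₁ + i₁) + b₁ * w)
      ≡⟨ rearrange K w u₁ i₁ b₁ u₂ i₂ b₂ ⟩
    K * (u₁ + u₂ + (i₁ + i₂)) + (b₁ + b₂) * w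
      ≤⟨ +-monoʳ-≤ (K * (u₁ + u₂ + (i₁ + i₂))) (*-monoˡ-≤ w (budget-split X b)) ⟩
    K * (u₁ + u₂ + (i₁ + i₂)) + budget X b * w ∎
    where
    open ≤-Reasoning
    X₁ = leftPicks X
    X₂ = rightPicks X
    u₁ = unmarked (children g n f) (Q ∘ inl)
    u₂ = unmarked (f n) (Q ∘ inr)
    i₁ = inners (children g n f)
    i₂ = inners (f n)
    b₁ = budget X₁ b
    b₂ = budget X₂ b

    rearrange : ∀ K w u₁ i₁ b₁ u₂ i₂ b₂ → K * (u₂ + i₂) + b₂ * w + (K * (u₁ + i₁) + b₁ * w) ≡
                                          K * (u₁ + u₂ + (i₁ + i₂)) + (b₁ + b₂) * w
    rearrange = solve-∀

    last : w ≤ K * (u₂ + i₂) + b₂ * w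
    last with b₂ in eq
    ... | zero  = ≤-trans (h n ≤-refl X₂ (Q ∘ inr) (budget-quiet b eq) (soundʳ quiet sound)) (m≤m+n _ _)
    ... | suc b = ≤-trans (m≤m+n w (b * w)) (m≤n+m _ (K * (u₂ + i₂)))

  -- The chain vertices lie above depth `τ + c`, so silence up to that time leaves no pick that
  -- could save one of them, and every valid witness lies in `t`.
  unmarked-chain : ∀ c {t τ} X Q → Quiet (τ + c) X → Sound τ X Q →
    Σ[ X′ ∈ Picks t ] Σ[ Q′ ∈ (Vertex t → Bool) ]
      Quiet (τ + c) X′ × Sound (τ + c) X′ Q′ × unmarked t Q′ ≤ unmarked (chain c t) Q
  unmarked-chain zero {t} {τ} X Q quiet sound =
    X , Q , quiet , subst (λ d → Sound d X Q) (sym (+-identityʳ τ)) sound , ≤-refl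
  unmarked-chain (suc c) {t} {τ} X Q quiet sound rewrite +-suc τ c =
    let (X′ , Q′ , quiet′ , sound′ , ≤chain) = unmarked-chain c (rightPicks X) (Q ∘ inr)
          (quietʳ quiet)
          (soundʳ (λ i i<τ → quiet i (<-≤-trans i<τ (m≤n⇒m≤1+n (m≤m+n τ c)))) sound)
    in X′ , Q′ , quiet′ , sound′ , ≤-trans ≤chain (m≤n+m _ _)

-- The gap tree: its layers, and how much of it must burn

module Construction (r : ℕ) where

  open import Data.Bool.Base using (Bool; true; false)
  open import Data.Nat.Base
  open import Data.Nat.Divisibility using (_∣_; divides; ∣-trans; n∣m*n)
  open import Data.Nat.DivMod using (m*n/n≡m; m<n*o⇒m/o<n; m/n*n≤m; m≡m%n+[m/n]*n; m%n<n)
  open import Data.Nat.GeneralisedArithmetic using (fold)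
  open import Data.Nat.Properties
  open import Data.Nat.Tactic.RingSolver using (solve-∀)
  open import Data.Product.Base using (_×_; _,_; proj₁; proj₂; Σ-syntax)
  open import Relation.Binary.Definitions using (tri<; tri≈; tri>)
  open import Relation.Binary.PropositionalEquality
  open import Relation.Nullary using (yes; no)
  open Trees
  open Combinatorics

  m k : ℕ
  m = suc r
  k = suc m

  -- A vertex entered at time T owns the layers T + 1, …, T + blockLength T; the blocks of the
  -- vertices below branch j of it lie between entry s T j and entry s T (j + 1).
  blockLength degree : ℕ → ℕ
  blockLength T = m * suc T
  degree T = k * blockLength T

  -- Branches are served one after another: iterating `finish s` lets each enter where the previous
  -- one has used up its layers. Entry times, and hence degrees, differ between branches.
  finish : ℕ → ℕ → ℕ
  entry  : ℕ → ℕ → ℕ → ℕ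
  finish zero    T = T
  finish (suc s) T = fold (T + blockLength T) (finish s) (degree T)
  entry s T = fold (T + blockLength T) (finish s)

  -- The chain length that puts child `j` at depth `T + 1 + j / k`: `T ∸ τ` passes the layers before
  -- the block, and `j / k` places `k` children in each of its layers.
  offset : (τ T j : ℕ) → ℕ
  offset τ T j = (T ∸ τ) + j / k

  -- The root of build b s τ T W lies at depth τ and is entered at time T; the subtree has s further
  -- guarded levels and W leaves, W being a multiple of denominator s T.
  build  : Bool → (s τ T W : ℕ) → Tree
  branch : (s τ T W j : ℕ) → Tree
  build b zero    τ T W = children b W (λ _ → ∙ leaf)
  build b (suc s) τ T W = children b (degree T) (branch s τ T W)
  branch s τ T W j = chain (offset τ T j)
    (build true s (suc τ + offset τ T j) (entry s T j) (W / degree T))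

  -- Since degrees differ between branches, a product over all branches serves as a common multiple;
  -- it makes the leaves divide evenly at every level.
  denominator : (s T : ℕ) → ℕ
  denominator zero    T = 1
  denominator (suc s) T = Π (λ j → denominator s (entry s T j)) (degree T) * degree T

  denominator-positive : ∀ s T → 0 < denominator s T
  denominator-positive zero    T = s≤s z≤n
  denominator-positive (suc s) T = *-mono-≤
    (Π-positive (degree T) (λ j → denominator-positive s (entry s T j))) (s≤s z≤n)

  split-weight : ∀ s {T W} → denominator (suc s) T ∣ W →
    degree T * (W / degree T) ≡ W × (∀ j → j < degree T → denominator s (entry s T j) ∣ W / degree T)
  split-weight s {T} {W} (divides q refl) = whole , part
    where
    p = Π (λ j → denominator s (entry s T j)) (degree T)
    quotient : W / degree T ≡ q * p
    quotient = trans (cong (_/ degree T) (sym (*-assoc q p (degree T)))) (m*n/n≡m (q * p) (degree T))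
    whole : degree T * (W / degree T) ≡ W
    whole = trans (cong (degree T *_) quotient)
      (trans (*-comm (degree T) (q * p)) (*-assoc q p (degree T)))
    part : ∀ j → j < degree T → denominator s (entry s T j) ∣ W / degree T
    part j j<N rewrite quotient = ∣-trans (∣Π _ (degree T) j<N) (n∣m*n q)

  leaves-build : ∀ b s τ T W → denominator s T ∣ W → leaves (build b s τ T W) ≡ W
  leaves-build b zero τ T W _ =
    trans (leaves-children b W (λ _ → ∙ leaf)) (trans (Σ-const W (λ _ _ → refl)) (*-identityʳ W))
  leaves-build b (suc s) τ T W D∣W =
    let (whole , part) = split-weight s {T} D∣W
    in trans (leaves-children b (degree T) (branch s τ T W))
      (trans (Σ-const (degree T) λ j j<N → trans (leaves-chain (offset τ T j) _)
                (leaves-build true s (suc τ + offset τ T j) (entry s T j) _ (part j j<N)))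
        whole)

  -- `W` only decides how many leaves hang below the last guarded level. Hence `W` may be chosen
  -- after the inner vertices have been counted.
  inners-build : ∀ b s τ T W W′ → inners (build b s τ T W) ≡ inners (build b s τ T W′)
  inners-build b zero τ T W W′ = trans (star W) (sym (star W′))
    where
    star : ∀ W → inners (children b W (λ _ → ∙ leaf)) ≡ 1
    star W = trans (inners-children b W _) (cong suc (Σ-zero W (λ _ _ → refl)))
  inners-build b (suc s) τ T W W′ =
    trans (inners-children b (degree T) (branch s τ T W))
      (trans (cong suc (Σ-cong (degree T) λ j →
          trans (inners-chain (offset τ T j) _)
            (trans (cong (offset τ T j +_) (inners-build true s _ (entry s T j) _ _))
              (sym (inners-chain (offset τ T j) _)))))
        (sym (inners-children b (degree T) (branch s τ T W′))))

  leafWeight-build : ∀ b s τ T W → LeafWeight (build b s τ T W) (weight (inner b) + s)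
  leafWeight-build b zero    τ T W = leafWeight-children b W λ { j ⋆ refl → refl }
  leafWeight-build b (suc s) τ T W = leafWeight-children b (degree T) λ j →
    leafWeight-chain (offset τ T j) (leafWeight-build true s _ (entry s T j) _)

  label-root-build : ∀ b s τ T W → label (root (build b s τ T W)) ≡ inner b
  label-root-build b zero    τ T W = label-root-children b W _
  label-root-build b (suc s) τ T W = label-root-children b (degree T) _

  layerWeight-root-build : ∀ b s τ T W → layerWeight (build b s τ T W) 0 ≤ 1
  layerWeight-root-build b zero    τ T W =
    ≤-trans (≤-reflexive (layerWeight-root b W _)) (weight≤1 (inner b))
  layerWeight-root-build b (suc s) τ T W =
    ≤-trans (≤-reflexive (layerWeight-root b (degree T) _)) (weight≤1 (inner b))

  finish-increasing : ∀ s T → T ≤ finish s T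
  entry-increasing  : ∀ s T {i j} → i ≤′ j → entry s T i ≤ entry s T j
  finish-increasing zero    T = ≤-refl
  finish-increasing (suc s) T = ≤-trans (m≤m+n T (blockLength T)) (entry-increasing s T (z≤′n {degree T}))
  entry-increasing s T (≤′-reflexive refl) = ≤-refl
  entry-increasing s T (≤′-step {j} i≤j)   =
    ≤-trans (entry-increasing s T i≤j) (finish-increasing s (entry s T j))

  entry-mono : ∀ s T {i j} → i ≤ j → entry s T i ≤ entry s T j
  entry-mono s T i≤j = entry-increasing s T (≤⇒≤′ i≤j)

  block≤entry : ∀ s T j → T + blockLength T ≤ entry s T j
  block≤entry s T j = entry-mono s T {0} {j} z≤n

  offset-in-block : ∀ {τ T} j → τ ≤ T → j < degree T → suc τ + offset τ T j ≤ T + blockLength T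
  offset-in-block {τ} {T} j τ≤T j<N = begin
    suc τ + ((T ∸ τ) + j / k)   ≡⟨ +-assoc (suc τ) (T ∸ τ) (j / k) ⟨
    suc (τ + (T ∸ τ)) + j / k   ≡⟨ cong (λ x → suc x + j / k) (m+[n∸m]≡n τ≤T) ⟩
    suc T + j / k               ≡⟨ +-suc T (j / k) ⟨
    T + suc (j / k)             ≤⟨ +-monoʳ-≤ T (m<n*o⇒m/o<n (subst (j <_) (*-comm k (blockLength T)) j<N)) ⟩
    T + blockLength T           ∎
    where open ≤-Reasoning

  -- Layers are given by absolute depth `τ + suc d`. The root is left out because it is accounted
  -- for in the block of its parent.
  Confined : Tree → (τ T E : ℕ) → Set
  Confined t τ T E = ∀ d →
    layerWeight t (suc d) ≤ k ×
    (τ + suc d ≤ T → layerWeight t (suc d) ≡ 0) ×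
    (E < τ + suc d → layerWeight t (suc d) ≡ 0)

  -- Up to the end of the block a layer meets only children of the root, at most `k` of which share
  -- a value of `j / k`. Further down it falls into the interval of at most one branch, where the
  -- induction hypothesis applies.
  build-confined   : ∀ b s τ T W → τ ≤ T → Confined (build b s τ T W) τ T (finish s T)
  build-confined b zero τ T W τ≤T d = ≤-trans (≤-reflexive ≡0) z≤n , (λ _ → ≡0) , (λ _ → ≡0)
    where
    ≡0 : layerWeight (children b W (λ _ → ∙ leaf)) (suc d) ≡ 0
    ≡0 = trans (layerWeight-children b W (λ _ → ∙ leaf) d) (Σ-zero W (λ _ _ → leaf-zero d))
      where
      leaf-zero : ∀ d → layerWeight (∙ leaf) d ≡ 0
      leaf-zero zero    = refl
      leaf-zero (suc d) = refl
  build-confined b (suc s) τ T W τ≤T d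
    rewrite layerWeight-children b (degree T) (branch s τ T W) d | +-suc τ d =
      ≤k , (λ D≤T → Σ-zero N λ j j<N → early j (D≤T⇒d<offset j D≤T))
         , (λ E<D → Σ-zero N λ j j<N → late j j<N (≤-<-trans (entry-mono s T j<N) E<D))
    where
    N = degree T
    D = suc (τ + d)
    g : ℕ → ℕ
    g j = layerWeight (branch s τ T W j) d
    c = offset τ T
    sub : ℕ → Tree
    sub j = build true s (suc τ + c j) (entry s T j) (W / N)

    sub-confined : ∀ j → j < N → Confined (sub j) (suc τ + c j) (entry s T j) (entry s T (suc j))
    sub-confined j j<N = build-confined true s (suc τ + c j) (entry s T j) (W / N)
      (≤-trans (offset-in-block j τ≤T j<N) (block≤entry s T j))

    early : ∀ j → d < c j → g j ≡ 0
    early j d<c = layerWeight-chain-< (c j) d<c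

    at : ∀ j → d ≡ c j → g j ≤ 1
    at j d≡c = ≤-trans (≤-reflexive (trans
      (cong (layerWeight (branch s τ T W j)) (trans d≡c (sym (+-identityʳ (c j)))))
      (layerWeight-chain-+ (c j) (sub j) 0)))
      (layerWeight-root-build true s _ (entry s T j) _)

    below : ∀ j → c j < d → Σ[ e ∈ ℕ ] (D ≡ suc τ + c j + suc e × g j ≡ layerWeight (sub j) (suc e))
    below j c<d with m≤n⇒∃[o]m+o≡n c<d
    ... | e , refl = e , cong suc (trans (cong (τ +_) (sym (+-suc (c j) e))) (sym (+-assoc τ (c j) (suc e))))
      , trans (cong (layerWeight (branch s τ T W j)) (sym (+-suc (c j) e)))
          (layerWeight-chain-+ (c j) (sub j) (suc e))

    not-yet : ∀ j → j < N → D ≤ entry s T j → d ≢ c j → g j ≡ 0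
    not-yet j j<N D≤ d≢c with <-cmp d (c j)
    ... | tri< d<c _ _ = early j d<c
    ... | tri≈ _ d≡c _ with () ← d≢c d≡c
    ... | tri> _ _ c<d with below j c<d
    ...   | e , D≡ , g≡ = trans g≡ (proj₁ (proj₂ (sub-confined j j<N e)) (subst (_≤ entry s T j) D≡ D≤))

    late : ∀ j → j < N → entry s T (suc j) < D → g j ≡ 0
    late j j<N <D with below j (+-cancelˡ-< (suc τ) (c j) d (≤-<-trans
      (≤-trans (offset-in-block j τ≤T j<N) (block≤entry s T (suc j))) <D))
    ... | e , D≡ , g≡ = trans g≡ (proj₂ (proj₂ (sub-confined j j<N e)) (subst (entry s T (suc j) <_) D≡ <D))

    g≤k : ∀ j → j < N → g j ≤ k
    g≤k j j<N with <-cmp d (c j)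
    ... | tri< d<c _ _ = ≤-trans (≤-reflexive (early j d<c)) z≤n
    ... | tri≈ _ d≡c _ = ≤-trans (at j d≡c) (s≤s z≤n)
    ... | tri> _ _ c<d with below j c<d
    ...   | e , _ , g≡ = ≤-trans (≤-reflexive g≡) (proj₁ (sub-confined j j<N e))

    D≤T⇒d<offset : ∀ j → D ≤ T → d < c j
    D≤T⇒d<offset j D≤T = ≤-trans
      (m+n≤o⇒m≤o∸n (suc d) (≤-trans (≤-reflexive (cong suc (+-comm d τ))) D≤T))
      (m≤m+n (T ∸ τ) (j / k))

    -- The position of layer `D` within the block: a child in this layer has `j / k` equal to `a`,
    -- so the window of indices starts at `a * k`.
    a = d ∸ (T ∸ τ)

    ≤k : Σ g N ≤ k
    ≤k with D ≤? T + blockLength T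
    ... | no D≰ = Σ-intervals (entry s T) (entry-mono s T) N g≤k
            (λ j j<N D≤entry → not-yet j j<N D≤entry λ { refl → D≰ (offset-in-block j τ≤T j<N) })
            late
    ... | yes D≤ = Σ-window N (a * k) k
            (λ j j<N → at-most-one j j<N)
            (λ j j<N j<lo → outside j j<N λ d≡c →
              <⇒≱ j<lo (≤-trans (*-monoˡ-≤ k (≤-reflexive (a≡j/k j d≡c))) (m/n*n≤m j k)))
            (λ j j<N hi≤j → outside j j<N λ d≡c → <⇒≱ (j<a*k+k j d≡c) hi≤j)
      where
      outside : ∀ j → j < N → d ≢ c j → g j ≡ 0
      outside j j<N = not-yet j j<N (≤-trans D≤ (block≤entry s T j))
      at-most-one : ∀ j → j < N → g j ≤ 1
      at-most-one j j<N with d ≟ c j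
      ... | yes d≡c = at j d≡c
      ... | no  d≢c = ≤-trans (≤-reflexive (outside j j<N d≢c)) z≤n

      a≡j/k : ∀ j → d ≡ c j → a ≡ j / k
      a≡j/k j refl = m+n∸m≡n (T ∸ τ) (j / k)
      j<a*k+k : ∀ j → d ≡ c j → j < a * k + k
      j<a*k+k j d≡c = begin-strict
        j                  ≡⟨ m≡m%n+[m/n]*n j k ⟩
        j % k + j / k * k  <⟨ +-monoˡ-< (j / k * k) (m%n<n j k) ⟩
        k + j / k * k      ≡⟨ +-comm k (j / k * k) ⟩
        j / k * k + k      ≡⟨ cong (λ x → x * k + k) (a≡j/k j d≡c) ⟨
        a * k + k          ∎
        where open ≤-Reasoning

  -- Each level keeps the fraction `r / m`, which is 1 - 1/m, of the leaves. Adding `inners` removes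
  -- every error term: a star can lose one leaf to the strategy, and its centre makes up for that
  -- leaf.
  unmarked-build : ∀ b s τ T W → τ ≤ T → denominator s T ∣ W → ∀ X Q → Quiet τ X → Sound τ X Q →
    r ^ s * W ≤ m ^ s * (unmarked (build b s τ T W) Q + inners (build b s τ T W))
  -- Only the pick at time `τ + 1` can still save a leaf of the star; it is balanced by the 1 gained
  -- from the centre.
  unmarked-build b zero τ T W τ≤T _ X Q quiet sound = +-cancelʳ-≤ 1 (1 * W) (1 * Z) (begin
    1 * W + 1                      ≡⟨ cong (_+ 1) (*-comm 1 W) ⟩
    W * 1 + 1                      ≤⟨ unmarked-children (suc τ) b W leaf-unsaved X Q quiet sound ⟩
    1 * Z + budget X (suc τ) * 1   ≤⟨ +-monoʳ-≤ (1 * Z) (*-monoˡ-≤ 1 (quiet-budget τ quiet)) ⟩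
    1 * Z + 1                      ∎)
    where
    open ≤-Reasoning
    star = children b W (λ _ → ∙ leaf)
    Z = unmarked star Q + inners star

    leaf-unsaved : ∀ j → j < W → ∀ X Q → Quiet (suc τ) X → Sound (suc τ) X Q →
                   1 ≤ 1 * (unmarked (∙ leaf) Q + inners (∙ leaf))
    leaf-unsaved _ _ X Q quiet sound with Q ⋆ in eq
    ... | false = ≤-refl
    ... | true with sound ⋆ eq
    ...   | i , ⋆ , Xi , _ , i< with () ← trans (sym Xi) (quiet i (subst (i <_) (+-identityʳ (suc τ)) i<))
  -- Adding `N * w` to both sides replaces a subtraction: on the left it turns the factor `r` into
  -- `m`, on the right it absorbs the branches lost to picks.
  unmarked-build b (suc s) τ T W τ≤T D∣W X Q quiet sound = +-cancelʳ-≤ (N * w) _ _ (begin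
    r ^ suc s * W + N * w
      ≡⟨ cong (λ x → r ^ suc s * x + N * w) (sym whole) ⟩
    r * r ^ s * (N * V) + N * w
      ≡⟨ collect r (r ^ s) N V ⟩
    m * (N * w)
      ≤⟨ *-monoʳ-≤ m hit ⟩
    m * (m ^ s * Z + (T + L) * w)
      ≡⟨ expand m (m ^ s) Z (T + L) w ⟩
    m ^ suc s * Z + (m * (T + L)) * w
      ≤⟨ +-monoʳ-≤ (m ^ suc s * Z) (*-monoˡ-≤ w block-ratio) ⟩
    m ^ suc s * Z + N * w ∎)
    where
    open ≤-Reasoning
    N = degree T
    L = blockLength T
    V = W / N
    w = r ^ s * V
    whole = proj₁ (split-weight s {T} D∣W)
    tree = build b (suc s) τ T W
    Z = unmarked tree Q + inners tree

    collect : ∀ r p N V → r * p * (N * V) + N * (p * V) ≡ suc r * (N * (p * V))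
    collect = solve-∀

    expand : ∀ m p Z b w → m * (p * Z + b * w) ≡ m * p * Z + m * b * w
    expand = solve-∀

    -- The block length is made for this: `L` is `m * suc T`, hence at least `m * T`, while `N` is
    -- `L + m * L`.
    block-ratio : m * (T + L) ≤ N
    block-ratio = begin
      m * (T + L)      ≡⟨ *-distribˡ-+ m T L ⟩
      m * T + m * L    ≤⟨ +-monoˡ-≤ (m * L) (*-monoʳ-≤ m (n≤1+n T)) ⟩
      N                ∎

    -- The chain of branch `j` ends within the block, so silence until the end of the block means
    -- that the guarded child burns.
    child : ∀ j → j < N → ∀ X Q → Quiet (T + L) X → Sound (suc τ) X Q →
            w ≤ m ^ s * (unmarked (branch s τ T W j) Q + inners (branch s τ T W j))
    child j j<N X Q quiet sound =
      let c = offset τ T j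
          τ′≤ = offset-in-block j τ≤T j<N
          (X′ , Q′ , quiet′ , sound′ , ≤chain) = unmarked-chain c X Q
            (λ i i< → quiet i (<-≤-trans i< τ′≤)) sound
      in ≤-trans
        (unmarked-build true s (suc τ + c) (entry s T j) V (≤-trans τ′≤ (block≤entry s T j))
          (proj₂ (split-weight s {T} D∣W) j j<N) X′ Q′ quiet′ sound′)
        (*-monoʳ-≤ (m ^ s) (+-mono-≤ ≤chain
          (≤-trans (m≤n+m _ c) (≤-reflexive (sym (inners-chain c _))))))

    hit : N * w ≤ m ^ s * Z + (T + L) * w
    hit = begin
      N * w                                ≤⟨ m≤m+n (N * w) (m ^ s) ⟩
      N * w + m ^ s                        ≤⟨ unmarked-children (T + L) b N child X Q quiet sound ⟩
      m ^ s * Z + budget X (T + L) * w     ≤⟨ +-monoʳ-≤ (m ^ s * Z) (*-monoˡ-≤ w (budget-≤ X (T + L))) ⟩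
      m ^ s * Z + (T + L) * w              ∎

-- From tree counts to strategies and to a feasible LP solution

module Firefighting where

  open import Data.Bool.Base using (Bool; true; false; if_then_else_)
  open import Data.Fin.Base as Fin using (Fin; toℕ)
  import Data.Integer.Base as ℤ
  import Data.Integer.Tactic.RingSolver as ℤ-solver
  open import Data.Integer.Properties using (pos-+; pos-*)
  open import Data.List.Base using (List; []; _∷_; _++_; map; length; filter; lookup)
  open import Data.List.Membership.Propositional using (_∈_)
  open import Data.List.Membership.Propositional.Properties using (∈-lookup; ∈-applyUpTo⁻)
  open import Data.List.Properties using (map-∘; map-++; map-cong; filter-++; length-++)
  open import Data.Maybe.Base using (just)
  open import Data.Nat.Base
  open import Data.Nat.ListAction using (sum)
  open import Data.Nat.ListAction.Properties using (sum-++)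
  open import Data.Nat.Properties
  open import Data.Nat.Tactic.RingSolver using (solve-∀)
  open import Data.Product.Base using (_×_; _,_)
  import Data.Rational.Base as ℚ
  import Data.Rational.Properties as ℚₚ
  import Data.Rational.Unnormalised.Base as ℚᵘ
  import Data.Rational.Unnormalised.Properties as ℚᵘₚ
  open import Function.Base using (_∘_)
  open import Relation.Binary.PropositionalEquality
  open import Relation.Nullary using (Dec; does; _because_; invert)
  open import Defs using (ℝ; seq; 0ℝ; 1ℝ; fromℚ; fromℕ; ∑; /-≤; Strategy; saved?; L; dist; Feasible; IsLP)
    renaming (_≤_ to _≤ℝ_; P to rootPath)
  open Trees
  open Combinatorics

  treeSum : ∀ t → (Vertex t → ℕ) → ℕ
  treeSum t f = sum (map f (vertices t))

  treeSum-⊕ : ∀ {A B} (f : Vertex (A ⊕ B) → ℕ) →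
              treeSum (A ⊕ B) f ≡ treeSum A (f ∘ inl) + treeSum B (f ∘ inr)
  treeSum-⊕ {A} {B} f = trans (cong sum (map-++ f (map inl (vertices A)) (map inr (vertices B))))
    (trans (sum-++ (map f (map inl (vertices A))) _)
      (sym (cong₂ _+_ (cong sum (map-∘ (vertices A))) (cong sum (map-∘ (vertices B))))))

  treeSum-cong : ∀ t {f g : Vertex t → ℕ} → (∀ v → f v ≡ g v) → treeSum t f ≡ treeSum t g
  treeSum-cong t f≡g = cong sum (map-cong f≡g (vertices t))

  treeSum-zero : ∀ t {f : Vertex t → ℕ} → (∀ v → f v ≡ 0) → treeSum t f ≡ 0
  treeSum-zero (∙ _)   f≡0 = trans (+-identityʳ _) (f≡0 ⋆)
  treeSum-zero (A ⊕ B) f≡0 =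
    trans (treeSum-⊕ {A} {B} _) (cong₂ _+_ (treeSum-zero A (f≡0 ∘ inl)) (treeSum-zero B (f≡0 ∘ inr)))

  sum-filter : {X : Set} {P : X → Set} (P? : ∀ x → Dec (P x)) (f : X → ℕ) (xs : List X) →
               sum (map f (filter P? xs)) ≡ sum (map (λ x → if does (P? x) then f x else 0) xs)
  sum-filter P? f []       = refl
  sum-filter P? f (x ∷ xs) with does (P? x)
  ... | true  = cong (f x +_) (sum-filter P? f xs)
  ... | false = sum-filter P? f xs

  layerWeight-treeSum : ∀ t j →
    treeSum t (λ v → if depth v ≡ᵇ j then weight (label v) else 0) ≡ layerWeight t j
  layerWeight-treeSum (∙ l) zero    = +-identityʳ _
  layerWeight-treeSum (∙ l) (suc j) = refl
  layerWeight-treeSum (A ⊕ B) zero  =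
    trans (treeSum-⊕ {A} {B} _) (trans
      (cong₂ _+_ (layerWeight-treeSum A 0) (treeSum-zero B λ _ → refl)) (+-identityʳ _))
  layerWeight-treeSum (A ⊕ B) (suc j) =
    trans (treeSum-⊕ {A} {B} _) (cong₂ _+_ (layerWeight-treeSum A (suc j)) (layerWeight-treeSum B j))

  sum-layer : ∀ t j → sum (map (weight ∘ label) (L (firefighter t) j)) ≡ layerWeight t j
  sum-layer t j = trans (sum-filter (λ v → dist (firefighter t) v ≟ j) (weight ∘ label) (vertices t))
    (trans (treeSum-cong t λ v → cong (λ d → if d ≡ᵇ j then weight (label v) else 0) (dist-depth v))
      (layerWeight-treeSum t j))

  sum-path : ∀ {t} (v : Vertex t) → sum (map (weight ∘ label) (path v)) ≡ pathWeight v
  sum-path {∙ l} ⋆           = +-identityʳ _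
  sum-path {A ⊕ B} (inl v)   = trans (cong sum (sym (map-∘ (path v)))) (sum-path v)
  sum-path {A ⊕ B} (inr v)   =
    cong (weight (label (root A)) +_) (trans (cong sum (sym (map-∘ (path v)))) (sum-path v))

  isLeaf : Label → ℕ
  isLeaf leaf      = 1
  isLeaf (inner _) = 0

  sum-leaves : ∀ t → treeSum t (isLeaf ∘ label) ≡ leaves t
  sum-leaves (∙ leaf)      = refl
  sum-leaves (∙ (inner _)) = refl
  sum-leaves (A ⊕ B)       = trans (treeSum-⊕ {A} {B} _) (cong₂ _+_ (sum-leaves A) (sum-leaves B))

  length-filter-map : {X Y : Set} {P : Y → Set} (P? : ∀ y → Dec (P y)) (f : X → Y) (xs : List X) →
                      length (filter P? (map f xs)) ≡ length (filter (P? ∘ f) xs)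
  length-filter-map P? f []       = refl
  length-filter-map P? f (x ∷ xs) with does (P? (f x))
  ... | true  = cong suc (length-filter-map P? f xs)
  ... | false = length-filter-map P? f xs

  marked+unmarked : ∀ t {P : Vertex t → Set} (P? : ∀ v → Dec (P v)) →
    length (filter P? (vertices t)) + unmarked t (does ∘ P?) ≡ leaves t + inners t
  marked+unmarked (∙ leaf) P? with does (P? ⋆)
  ... | true  = refl
  ... | false = refl
  marked+unmarked (∙ (inner _)) P? with does (P? ⋆)
  ... | true  = refl
  ... | false = refl
  marked+unmarked (A ⊕ B) P? = begin
    length (filter P? (map inl (vertices A) ++ map inr (vertices B))) + (uA + uB)
      ≡⟨ cong (λ xs → length xs + (uA + uB)) (filter-++ P? (map inl (vertices A)) _) ⟩
    length (filter P? (map inl (vertices A)) ++ filter P? (map inr (vertices B))) + (uA + uB)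
      ≡⟨ cong (_+ (uA + uB)) (length-++ (filter P? (map inl (vertices A)))) ⟩
    length (filter P? (map inl (vertices A))) + length (filter P? (map inr (vertices B))) + (uA + uB)
      ≡⟨ cong (_+ (uA + uB)) (cong₂ _+_
           (length-filter-map P? inl (vertices A)) (length-filter-map P? inr (vertices B))) ⟩
    sA + sB + (uA + uB)
      ≡⟨ swap sA sB uA uB ⟩
    (sA + uA) + (sB + uB)
      ≡⟨ cong₂ _+_ (marked+unmarked A (P? ∘ inl)) (marked+unmarked B (P? ∘ inr)) ⟩
    leaves A + inners A + (leaves B + inners B)
      ≡⟨ swap (leaves A) (inners A) (leaves B) (inners B) ⟩
    leaves A + leaves B + (inners A + inners B) ∎
    where
    open ≡-Reasoning
    sA = length (filter (P? ∘ inl) (vertices A))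
    sB = length (filter (P? ∘ inr) (vertices B))
    uA = unmarked A (does ∘ P? ∘ inl)
    uB = unmarked B (does ∘ P? ∘ inr)
    swap : ∀ a b c d → a + b + (c + d) ≡ a + c + (b + d)
    swap = solve-∀

  -- Links positions on a root path, in which `Saved` is phrased, to depths, in which `Sound` is
  -- phrased.
  data Descending {t : Tree} : ℕ → List (Vertex t) → Set where
    []  : ∀ {d} → Descending d []
    _∷_ : ∀ {d v vs} → depth v ≡ d → Descending (suc d) vs → Descending d (v ∷ vs)

  path-descending : ∀ {t} (v : Vertex t) → Descending 0 (path v)
  path-descending ⋆       = refl ∷ []
  path-descending (inl v) = left-part (path-descending v)
    where
    left-part : ∀ {A B d vs} → Descending {A} d vs → Descending {A ⊕ B} d (map inl vs)
    left-part []       = []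
    left-part (p ∷ ps) = p ∷ left-part ps
  path-descending {A ⊕ B} (inr v) = depth-root A ∷ right-part (path-descending v)
    where
    right-part : ∀ {d vs} → Descending {B} d vs → Descending {A ⊕ B} (suc d) (map inr vs)
    right-part []       = []
    right-part (p ∷ ps) = cong suc p ∷ right-part ps

  descending-lookup : ∀ {t d} {vs : List (Vertex t)} → Descending d vs →
                      ∀ i → depth (lookup vs i) ≡ d + toℕ i
  descending-lookup (p ∷ ps) Fin.zero    = trans p (sym (+-identityʳ _))
  descending-lookup (p ∷ ps) (Fin.suc i) = trans (descending-lookup ps i) (sym (+-suc _ (toℕ i)))

  module _ (t : Tree) (U : Strategy (firefighter t)) where

    picks : Picks t
    picks i = just (U (suc i))

    -- Position `i` on the root path has depth `i`, and `picks j` happens at time `j + 1`; a vertex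
    -- among the first `i` picks therefore has an index `j < i`.
    saved-sound : Sound 0 picks (λ v → does (saved? (firefighter t) U v))
    saved-sound v eq with saved? (firefighter t) U v | eq
    ... | true because [saved] | _ with invert [saved]
    ... | i , _ , picked with on-path (rootPath (firefighter t) v) (rootPath-path v) i
      where
      on-path : ∀ vs → vs ≡ path v → ∀ i → lookup vs i ∈ path v × depth (lookup vs i) ≡ toℕ i
      on-path _ refl i = ∈-lookup i , descending-lookup (path-descending v) i
    ... | u∈ , depth≡ with ∈-applyUpTo⁻ (U ∘ suc) picked
    ... | j , j< , u≡ = j , _ , cong just (sym u≡) , u∈ , subst (j <_) (sym depth≡) j<

  /-+ : ∀ a b d .{{_ : NonZero d}} → ℤ.+ a ℚ./ d ℚ.+ ℤ.+ b ℚ./ d ≡ ℤ.+ (a + b) ℚ./ d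
  /-+ a b d@(suc d-1) = ℚₚ.toℚᵘ-injective
    (ℚᵘₚ.≃-trans (ℚₚ.toℚᵘ-homo-+ (ℤ.+ a ℚ./ d) (ℤ.+ b ℚ./ d))
    (ℚᵘₚ.≃-trans (ℚᵘₚ.+-cong (ℚₚ.toℚᵘ-fromℚᵘ (ℚᵘ.mkℚᵘ (ℤ.+ a) d-1)) (ℚₚ.toℚᵘ-fromℚᵘ (ℚᵘ.mkℚᵘ (ℤ.+ b) d-1)))
    (ℚᵘₚ.≃-trans
      (ℚᵘ.*≡* (trans (shape (ℤ.+ a) (ℤ.+ b) (ℤ.+ d)) (cong₂ ℤ._*_ (sym (pos-+ a b)) (sym (pos-* d d)))))
      (ℚᵘₚ.≃-sym (ℚₚ.toℚᵘ-fromℚᵘ (ℚᵘ.mkℚᵘ (ℤ.+ (a + b)) d-1))))))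
    where
    shape : ∀ a b d → (a ℤ.* d ℤ.+ b ℤ.* d) ℤ.* d ≡ (a ℤ.+ b) ℤ.* (d ℤ.* d)
    shape = ℤ-solver.solve-∀

  sum-fractions : {X : Set} (f : X → ℕ) (d : ℕ) .{{_ : NonZero d}} (xs : List X) → ∀ n →
    seq (∑ xs (λ x → fromℚ (ℤ.+ f x ℚ./ d))) n ≡ ℤ.+ sum (map f xs) ℚ./ d
  sum-fractions f d [] n = ℚₚ.≤-antisym (/-≤ 0 0 1 d z≤n) (/-≤ 0 0 d 1 z≤n)
  sum-fractions f d (x ∷ xs) n =
    trans (cong (ℤ.+ f x ℚ./ d ℚ.+_) (sum-fractions f d xs n)) (/-+ (f x) (sum (map f xs)) d)

  pointwise-≤ : ∀ x y → (∀ n → seq x n ℚ.≤ seq y n) → x ≤ℝ y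
  pointwise-≤ x y x≤y δ 0<δ = 0 , λ n _ → ℚₚ.≤-trans (x≤y n)
    (subst (ℚ._≤ seq y n ℚ.+ δ) (ℚₚ.+-identityʳ (seq y n)) (ℚₚ.+-monoʳ-≤ (seq y n) (ℚₚ.<⇒≤ 0<δ)))

  module Fractional (t : Tree) (k-1 : ℕ)
    (root-unweighted : label (root t) ≡ inner false)
    (layers : ∀ d → layerWeight t (suc d) ≤ suc k-1)
    (paths  : LeafWeight t (suc k-1)) where

    k : ℕ
    k = suc k-1

    -- `y` credits leaves only, since inner vertices will be too few to matter.
    x y : Vertex t → ℝ
    x v = fromℚ (ℤ.+ weight (label v) ℚ./ k)
    y v = fromℕ (isLeaf (label v))

    covered : ∀ v → isLeaf (label v) * k ≤ pathWeight v * 1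
    covered v with label v in eq
    ... | inner _ = z≤n
    ... | leaf    = ≤-reflexive (trans (*-comm 1 k) (cong (_* 1) (sym (paths v eq))))

    weight≤k : ∀ l → weight l * 1 ≤ 1 * k
    weight≤k l = ≤-trans (*-monoˡ-≤ 1 (weight≤1 l)) (s≤s z≤n)

    isLeaf≤1 : ∀ l → isLeaf l * 1 ≤ 1 * 1
    isLeaf≤1 leaf      = ≤-refl
    isLeaf≤1 (inner _) = z≤n

    feasible : Feasible (firefighter t) x y
    feasible = record
      { layer = λ { (suc j) _ → pointwise-≤ (∑ (L (firefighter t) (suc j)) x) 1ℝ λ n →
          subst (ℚ._≤ ℤ.+ 1 ℚ./ 1)
          (sym (sum-fractions (weight ∘ label) k (L (firefighter t) (suc j)) n))
          (/-≤ (sum (map (weight ∘ label) (L (firefighter t) (suc j)))) 1 k 1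
            (≤-trans (≤-reflexive (trans (*-identityʳ _) (sum-layer t (suc j))))
              (≤-trans (layers j) (≤-reflexive (sym (*-identityˡ k)))))) }
      ; cover = λ v → pointwise-≤ (y v) (∑ (rootPath (firefighter t) v) x) λ n →
          subst (ℤ.+ isLeaf (label v) ℚ./ 1 ℚ.≤_)
          (sym (sum-fractions (weight ∘ label) k (rootPath (firefighter t) v) n))
          (/-≤ (isLeaf (label v)) (sum (map (weight ∘ label) (rootPath (firefighter t) v))) 1 k
            (subst (λ w → isLeaf (label v) * k ≤ w * 1)
              (sym (trans (cong (sum ∘ map (weight ∘ label)) (rootPath-path v)) (sum-path v)))
              (covered v)))
      ; 0≤x   = λ v → pointwise-≤ 0ℝ (x v) λ n → /-≤ 0 (weight (label v)) 1 k z≤n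
      ; x≤1   = λ v → pointwise-≤ (x v) 1ℝ λ n → /-≤ (weight (label v)) 1 k 1 (weight≤k (label v))
      ; 0≤y   = λ v → pointwise-≤ 0ℝ (y v) λ n → /-≤ 0 (isLeaf (label v)) 1 1 z≤n
      ; y≤1   = λ v → pointwise-≤ (y v) 1ℝ λ n → /-≤ (isLeaf (label v)) 1 1 1 (isLeaf≤1 (label v))
      ; x-s   = pointwise-≤ (x (root t)) 0ℝ (λ n → /-≤ (weight (label (root t))) 0 k 1
                  (≤-reflexive (cong ((_* 1) ∘ weight) root-unweighted)))
              , pointwise-≤ 0ℝ (x (root t)) (λ n → /-≤ 0 (weight (label (root t))) 1 k z≤n)
      }

    leaves≤lp : ∀ lp → IsLP (firefighter t) lp → fromℕ (leaves t) ≤ℝ lp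
    leaves≤lp lp (_ , optimal) δ 0<δ =
      let (N , ≤lp) = optimal x y feasible δ 0<δ
      in N , λ n N≤n → subst (ℚ._≤ seq lp n ℚ.+ δ)
        (trans (sum-fractions (isLeaf ∘ label) 1 (vertices t) n) (cong (λ w → ℤ.+ w ℚ./ 1) (sum-leaves t)))
        (≤lp n N≤n)

-- Rational bounds relating powers of 1 - 1/m to 1/e

module Exponential where

  open import Algebra.Bundles using (CommutativeRing)
  import Data.Integer.Base as ℤ
  open import Data.Integer.Properties using (pos-*)
  open import Data.Nat.Base as ℕ using (ℕ; zero; suc; _!)
  import Data.Nat.Properties as ℕₚ
  open import Data.Rational.Base
  open import Data.Rational.Properties
  open import Data.Rational.Solver using (module +-*-Solver)
  import Data.Rational.Unnormalised.Base as ℚᵘ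
  import Data.Rational.Unnormalised.Properties as ℚᵘₚ
  open import Relation.Binary.PropositionalEquality
  open import Algebra.Properties.CommutativeSemiring.Exp
    (CommutativeRing.commutativeSemiring +-*-commutativeRing) using (_^_; ^-distrib-*)
  open import Defs using (e-seq; 1/-pos; /-≤; *-mono) renaming (1/_! to inv!)
  open Firefighting using (/-+)

  ι : ℕ → ℚ
  ι n = ℤ.+ n / 1

  ι-+ : ∀ a b → ι (a ℕ.+ b) ≡ ι a + ι b
  ι-+ a b = sym (/-+ a b 1)

  ι-/ : ∀ a b d .{{_ : ℕ.NonZero d}} → ι a * (ℤ.+ b / d) ≡ ℤ.+ (a ℕ.* b) / d
  ι-/ a b d@(suc d-1) = toℚᵘ-injective
    (ℚᵘₚ.≃-trans (toℚᵘ-homo-* (ι a) (ℤ.+ b / d))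
    (ℚᵘₚ.≃-trans (ℚᵘₚ.*-cong (toℚᵘ-fromℚᵘ (ℚᵘ.mkℚᵘ (ℤ.+ a) 0)) (toℚᵘ-fromℚᵘ (ℚᵘ.mkℚᵘ (ℤ.+ b) d-1)))
    (ℚᵘₚ.≃-trans
      (ℚᵘ.*≡* (cong₂ ℤ._*_ (sym (pos-* a b)) (cong ℤ.+_ (sym (ℕₚ.*-identityˡ d)))))
      (ℚᵘₚ.≃-sym (toℚᵘ-fromℚᵘ (ℚᵘ.mkℚᵘ (ℤ.+ (a ℕ.* b)) d-1))))))

  ι-* : ∀ a b → ι (a ℕ.* b) ≡ ι a * ι b
  ι-* a b = sym (ι-/ a b 1)

  ι-^ : ∀ a n → ι (a ℕ.^ n) ≡ ι a ^ n
  ι-^ a zero    = refl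
  ι-^ a (suc n) = trans (ι-* a (a ℕ.^ n)) (cong (ι a *_) (ι-^ a n))

  ι-mono : ∀ {a b} → a ℕ.≤ b → ι a ≤ ι b
  ι-mono {a} {b} a≤b = /-≤ a b 1 1 (ℕₚ.*-monoˡ-≤ 1 a≤b)

  ι-≥0 : ∀ n → 0ℚ ≤ ι n
  ι-≥0 n = ι-mono {0} {n} ℕ.z≤n

  ι-inverse : ∀ n .{{_ : ℕ.NonZero n}} → ι n * (ℤ.+ 1 / n) ≡ 1ℚ
  ι-inverse n = trans (ι-/ n 1 n) (≤-antisym
    (/-≤ (n ℕ.* 1) 1 n 1 (ℕₚ.≤-reflexive n11≡1n))
    (/-≤ 1 (n ℕ.* 1) 1 n (ℕₚ.≤-reflexive (sym n11≡1n))))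
    where
    n11≡1n : n ℕ.* 1 ℕ.* 1 ≡ 1 ℕ.* n
    n11≡1n = trans (ℕₚ.*-identityʳ (n ℕ.* 1)) (ℕₚ.*-comm n 1)

  1/!-suc : ∀ n → ι (suc n) * inv! (suc n) ≡ inv! n
  1/!-suc n = trans (ι-/ (suc n) 1 (suc n !) {{suc-n!≢0}}) (≤-antisym
    (/-≤ (suc n ℕ.* 1) 1 (suc n !) (n !) {{suc-n!≢0}} {{n!≢0}} (ℕₚ.≤-reflexive eq))
    (/-≤ 1 (suc n ℕ.* 1) (n !) (suc n !) {{n!≢0}} {{suc-n!≢0}} (ℕₚ.≤-reflexive (sym eq))))
    where
    n!≢0 = ℕₚ._!≢0 n
    suc-n!≢0 = ℕₚ._!≢0 (suc n)
    eq : suc n ℕ.* 1 ℕ.* n ! ≡ 1 ℕ.* suc n !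
    eq = trans (cong (ℕ._* n !) (ℕₚ.*-identityʳ (suc n))) (sym (ℕₚ.*-identityˡ (suc n !)))

  0≤1/! : ∀ n → 0ℚ ≤ inv! n
  0≤1/! n = <⇒≤ (1/-pos (n !) {{ℕₚ._!≢0 n}})

  0≤1 : 0ℚ ≤ 1ℚ
  0≤1 = <⇒≤ (positive⁻¹ 1ℚ)

  0≤-* : ∀ {p q} → 0ℚ ≤ p → 0ℚ ≤ q → 0ℚ ≤ p * q
  0≤-* {p} {q} 0≤p 0≤q = nonNegative⁻¹ (p * q)
    {{nonNeg*nonNeg⇒nonNeg p {{nonNegative 0≤p}} q {{nonNegative 0≤q}}}}

  0≤-+ : ∀ {p q} → 0ℚ ≤ p → 0ℚ ≤ q → 0ℚ ≤ p + q
  0≤-+ 0≤p 0≤q = +-mono-≤ 0≤p 0≤q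

  ≤-+ʳ : ∀ p {q} → 0ℚ ≤ q → p ≤ p + q
  ≤-+ʳ p {q} 0≤q = subst (_≤ p + q) (+-identityʳ p) (+-monoʳ-≤ p 0≤q)

  *-monoˡ : ∀ {r p q} → 0ℚ ≤ r → p ≤ q → r * p ≤ r * q
  *-monoˡ {r} 0≤r = *-monoˡ-≤-nonNeg r {{nonNegative 0≤r}}

  *-monoʳ : ∀ {r p q} → 0ℚ ≤ r → p ≤ q → p * r ≤ q * r
  *-monoʳ {r} 0≤r = *-monoʳ-≤-nonNeg r {{nonNegative 0≤r}}

  0≤^ : ∀ {p} n → 0ℚ ≤ p → 0ℚ ≤ p ^ n
  0≤^ zero    0≤p = 0≤1
  0≤^ (suc n) 0≤p = 0≤-* 0≤p (0≤^ n 0≤p)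

  ^≤1 : ∀ {p} n → 0ℚ ≤ p → p ≤ 1ℚ → p ^ n ≤ 1ℚ
  ^≤1 zero    0≤p p≤1 = ≤-refl
  ^≤1 (suc n) 0≤p p≤1 = *-mono (0≤^ n 0≤p) 0≤1 p≤1 (^≤1 n 0≤p p≤1)

  1^ : ∀ n → 1ℚ ^ n ≡ 1ℚ
  1^ zero    = refl
  1^ (suc n) = trans (*-identityˡ (1ℚ ^ n)) (1^ n)

  expSum : ℕ → ℚ → ℚ
  expSum zero    t = 0ℚ
  expSum (suc n) t = expSum n t + t ^ n * inv! n

  e-seq-expSum : ∀ n → e-seq n ≡ expSum (suc n) 1ℚ
  e-seq-expSum zero    = refl
  e-seq-expSum (suc n) = cong₂ _+_ (e-seq-expSum n)
    (sym (trans (cong (_* inv! (suc n)) (1^ (suc n))) (*-identityˡ (inv! (suc n)))))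

  -- These are the first two terms of the binomial expansion of the right side; the others are
  -- nonnegative.
  power-increment : ∀ {t h} n → 0ℚ ≤ t → 0ℚ ≤ h →
                    t ^ suc n + ι (suc n) * (h * t ^ n) ≤ (t + h) ^ suc n
  power-increment {t} {h} zero _ _ = ≤-reflexive
    (solve 2 (λ t h → t :* con 1ℚ :+ con 1ℚ :* (h :* con 1ℚ) := (t :+ h) :* con 1ℚ) refl t h)
    where open +-*-Solver
  power-increment {t} {h} (suc n) 0≤t 0≤h = begin
    t * (t * p) + ι (suc (suc n)) * (h * (t * p))
      ≡⟨ cong (λ x → t * (t * p) + x * (h * (t * p))) (ι-+ 1 (suc n)) ⟩
    t * (t * p) + (1ℚ + c) * (h * (t * p))
      ≤⟨ ≤-+ʳ _ (0≤-* (ι-≥0 (suc n)) (0≤-* (0≤-* 0≤h 0≤h) (0≤^ n 0≤t))) ⟩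
    t * (t * p) + (1ℚ + c) * (h * (t * p)) + c * (h * h * p)
      ≡⟨ solve 4 (λ t h p c → t :* (t :* p) :+ (con 1ℚ :+ c) :* (h :* (t :* p)) :+ c :* (h :* h :* p)
           := (t :+ h) :* (t :* p :+ c :* (h :* p))) refl t h p c ⟩
    (t + h) * (t * p + c * (h * p))
      ≤⟨ *-monoˡ (0≤-+ 0≤t 0≤h) (power-increment n 0≤t 0≤h) ⟩
    (t + h) * (t + h) ^ suc n ∎
    where
    open ≤-Reasoning
    open +-*-Solver
    p = t ^ n
    c = ι (suc n)

  -- A tangent bound: `expSum n` is the derivative of `expSum (suc n)`, which is convex on
  -- nonnegative arguments.
  expSum-increment : ∀ {t h} n → 0ℚ ≤ t → 0ℚ ≤ h →
                     expSum (suc n) t + h * expSum n t ≤ expSum (suc n) (t + h)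
  expSum-increment {t} {h} zero _ _ = ≤-reflexive (trans
    (cong (0ℚ + 1ℚ * inv! 0 +_) (*-zeroʳ h)) (+-identityʳ (0ℚ + 1ℚ * inv! 0)))
  expSum-increment {t} {h} (suc n) 0≤t 0≤h = begin
    (a + q * c) + h * (b + p * inv! n)
      ≡⟨ cong (λ x → (a + q * c) + h * (b + p * x)) (1/!-suc n) ⟨
    (a + q * c) + h * (b + p * (i * c))
      ≡⟨ solve 7 (λ a b c h p q i → (a :+ q :* c) :+ h :* (b :+ p :* (i :* c))
           := (a :+ h :* b) :+ (q :+ i :* (h :* p)) :* c) refl a b c h p q i ⟩
    (a + h * b) + (q + i * (h * p)) * c
      ≤⟨ +-mono-≤ (expSum-increment n 0≤t 0≤h)
           (*-monoʳ (0≤1/! (suc n)) (power-increment n 0≤t 0≤h)) ⟩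
    expSum (suc n) (t + h) + (t + h) ^ suc n * c ∎
    where
    open ≤-Reasoning
    open +-*-Solver
    a = expSum (suc n) t
    b = expSum n t
    c = inv! (suc n)
    p = t ^ n
    q = t ^ suc n
    i = ι (suc n)

  -- A finite form of (1 + h)^n ≤ exp (n h): by the tangent bound, each factor `1 + h` advances the
  -- argument by `h` at the price of one more term.
  compound-≤-expSum : ∀ {h} n → 0ℚ ≤ h → (1ℚ + h) ^ n ≤ expSum (suc n) (ι n * h)
  compound-≤-expSum zero 0≤h = ≤-refl
  compound-≤-expSum {h} (suc n) 0≤h = begin
    (1ℚ + h) * (1ℚ + h) ^ n
      ≤⟨ *-monoˡ (0≤-+ 0≤1 0≤h) (compound-≤-expSum n 0≤h) ⟩
    (1ℚ + h) * s
      ≡⟨ solve 2 (λ h s → (con 1ℚ :+ h) :* s := s :+ h :* s) refl h s ⟩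
    s + h * s
      ≤⟨ +-monoˡ-≤ (h * s) (≤-+ʳ s (0≤-* (0≤^ (suc n) 0≤nh) (0≤1/! (suc n)))) ⟩
    expSum (suc (suc n)) (ι n * h) + h * s
      ≤⟨ expSum-increment (suc n) 0≤nh 0≤h ⟩
    expSum (suc (suc n)) (ι n * h + h)
      ≡⟨ cong (expSum (suc (suc n))) (trans
           (solve 2 (λ n h → n :* h :+ h := (con 1ℚ :+ n) :* h) refl (ι n) h)
           (cong (_* h) (sym (ι-+ 1 n)))) ⟩
    expSum (suc (suc n)) (ι (suc n) * h) ∎
    where
    open ≤-Reasoning
    open +-*-Solver
    s = expSum (suc n) (ι n * h)
    0≤nh : 0ℚ ≤ ι n * h
    0≤nh = 0≤-* (ι-≥0 n) 0≤h

  compound-≤-e : ∀ n .{{_ : ℕ.NonZero n}} → (1ℚ + ℤ.+ 1 / n) ^ n ≤ e-seq n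
  compound-≤-e n = ≤-trans (compound-≤-expSum n (<⇒≤ (1/-pos n)))
    (≤-reflexive (trans (cong (expSum (suc n)) (ι-inverse n)) (sym (e-seq-expSum n))))

  module Mesh (r-1 : ℕ) where

    r m : ℕ
    r = suc r-1
    m = suc r

    μ ρ : ℚ
    μ = ℤ.+ 1 / m
    ρ = 1ℚ - μ

    0≤μ : 0ℚ ≤ μ
    0≤μ = <⇒≤ (1/-pos m)

    mμ≡1 : ι m * μ ≡ 1ℚ
    mμ≡1 = ι-inverse m

    ρm≡r : ρ * ι m ≡ ι r
    ρm≡r = begin
      (1ℚ - μ) * ι m            ≡⟨ solve 2 (λ μ m → (con 1ℚ :- μ) :* m := m :- m :* μ) refl μ (ι m) ⟩
      ι m - ι m * μ             ≡⟨ cong₂ _-_ (ι-+ 1 r) mμ≡1 ⟩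
      1ℚ + ι r - 1ℚ             ≡⟨ solve 1 (λ r → con 1ℚ :+ r :- con 1ℚ := r) refl (ι r) ⟩
      ι r                       ∎
      where
      open ≡-Reasoning
      open +-*-Solver

    0≤ρ : 0ℚ ≤ ρ
    0≤ρ = subst (_≤ ρ) (+-inverseʳ μ) (+-monoˡ-≤ (- μ) (/-≤ 1 1 m 1 (ℕ.s≤s ℕ.z≤n)))

    ρ≤1 : ρ ≤ 1ℚ
    ρ≤1 = subst (ρ ≤_) (+-identityʳ 1ℚ) (+-monoʳ-≤ 1ℚ (neg-antimono-≤ 0≤μ))

    -- As `m` is `r + 1`, the factors are r/m and m/r. This turns the upper bound on (1 + 1/r)^r
    -- into a lower bound on `ρ ^ r`.
    ρ-inverse : ρ * (1ℚ + ℤ.+ 1 / r) ≡ 1ℚ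
    ρ-inverse = begin
      (1ℚ - μ) * (1ℚ + h)
        ≡⟨ solve 2 (λ μ h → (con 1ℚ :- μ) :* (con 1ℚ :+ h)
             := con 1ℚ :+ h :* con 1ℚ :- con 1ℚ :* μ :- h :* μ) refl μ h ⟩
      1ℚ + h * 1ℚ - 1ℚ * μ - h * μ
        ≡⟨ cong₂ (λ x y → 1ℚ + h * x - y * μ - h * μ)
             (trans (cong (_* μ) (sym (ι-+ 1 r))) mμ≡1) (ι-inverse r) ⟨
      1ℚ + h * ((1ℚ + ι r) * μ) - (ι r * h) * μ - h * μ
        ≡⟨ solve 3 (λ μ h r → con 1ℚ :+ h :* ((con 1ℚ :+ r) :* μ) :- (r :* h) :* μ :- h :* μ := con 1ℚ)
             refl μ h (ι r) ⟩
      1ℚ ∎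
      where
      open ≡-Reasoning
      open +-*-Solver
      h = ℤ.+ 1 / r

    1≤ρ^r*e : 1ℚ ≤ ρ ^ r * e-seq r
    1≤ρ^r*e = begin
      1ℚ                              ≡⟨ 1^ r ⟨
      1ℚ ^ r                          ≡⟨ cong (_^ r) ρ-inverse ⟨
      (ρ * (1ℚ + ℤ.+ 1 / r)) ^ r      ≡⟨ ^-distrib-* ρ _ r ⟩
      ρ ^ r * (1ℚ + ℤ.+ 1 / r) ^ r    ≤⟨ *-monoˡ (0≤^ r 0≤ρ) (compound-≤-e r) ⟩
      ρ ^ r * e-seq r                 ∎
      where open ≤-Reasoning

    q : ℚ
    q = ρ ^ suc m

    0≤q : 0ℚ ≤ q
    0≤q = 0≤^ (suc m) 0≤ρ

    q≤1 : q ≤ 1ℚ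
    q≤1 = ^≤1 (suc m) 0≤ρ ρ≤1

    -- For E = e this reads (1 - 1/m)^(m + 1) ≥ 1/e - 2/m.
    1≤[q+2μ]E : ∀ {E} → e-seq r ≤ E → 1ℚ ≤ E → 1ℚ ≤ (q + (μ + μ)) * E
    1≤[q+2μ]E {E} e≤E 1≤E = begin
      1ℚ
        ≤⟨ ≤-+ʳ 1ℚ (0≤-* 0≤μ 0≤μ) ⟩
      1ℚ + μ * μ
        -- The exponent `suc m` is `r + 2`; the two factors `ρ` beyond `ρ ^ r` cost at most `μ + μ`.
        ≡⟨ solve 1 (λ μ → con 1ℚ :+ μ :* μ
             := (con 1ℚ :- μ) :* ((con 1ℚ :- μ) :* con 1ℚ) :+ (μ :+ μ) :* con 1ℚ) refl μ ⟩
      ρ * (ρ * 1ℚ) + (μ + μ) * 1ℚ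
        ≤⟨ +-mono-≤ (*-monoˡ 0≤ρ (*-monoˡ 0≤ρ (≤-trans 1≤ρ^r*e (*-monoˡ (0≤^ r 0≤ρ) e≤E))))
             (*-monoˡ (0≤-+ 0≤μ 0≤μ) 1≤E) ⟩
      ρ * (ρ * (ρ ^ r * E)) + (μ + μ) * E
        ≡⟨ solve 4 (λ ρ p E μ → ρ :* (ρ :* (p :* E)) :+ (μ :+ μ) :* E
             := (ρ :* (ρ :* p) :+ (μ :+ μ)) :* E) refl ρ (ρ ^ r) E μ ⟩
      (q + (μ + μ)) * E ∎
      where
      open ≤-Reasoning
      open +-*-Solver

    -- Division by `m ^ suc m`: since `ρ` is r/m, this turns `r ^ suc m` into `q`.
    rationalise : ∀ {opt W ν} →
                r ℕ.^ suc m ℕ.* W ℕ.+ m ℕ.^ suc m ℕ.* opt ℕ.≤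
                  m ℕ.^ suc m ℕ.* (W ℕ.+ (ν ℕ.+ ν)) →
                  ι opt + q * ι W ≤ ι W + (ι ν + ι ν)
    rationalise {opt} {W} {ν} h = *-cancelˡ-≤-pos M {{M>0}} (begin
      M * (ι opt + q * ι W)
        ≡⟨ solve 4 (λ M o q w → M :* (o :+ q :* w) := (q :* M) :* w :+ M :* o) refl M (ι opt) q (ι W) ⟩
      q * M * ι W + M * ι opt
        ≡⟨ cong (λ x → x * ι W + M * ι opt) qM≡ ⟩
      ι R′ * ι W + M * ι opt
        ≡⟨ trans (ι-+ (R′ ℕ.* W) (M′ ℕ.* opt)) (cong₂ _+_ (ι-* R′ W) (ι-* M′ opt)) ⟨
      ι (R′ ℕ.* W ℕ.+ M′ ℕ.* opt)
        ≤⟨ ι-mono h ⟩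
      ι (M′ ℕ.* (W ℕ.+ (ν ℕ.+ ν)))
        ≡⟨ trans (ι-* M′ (W ℕ.+ (ν ℕ.+ ν))) (cong (M *_) (trans (ι-+ W (ν ℕ.+ ν)) (cong (ι W +_) (ι-+ ν ν)))) ⟩
      M * (ι W + (ι ν + ι ν)) ∎)
      where
      open ≤-Reasoning
      open +-*-Solver
      R′ = r ℕ.^ suc m
      M′ = m ℕ.^ suc m
      M = ι M′
      M>0 : Positive M
      M>0 = normalize-pos M′ 1 {{_}} {{ℕₚ.m^n≢0 m (suc m)}}
      qM≡ : q * M ≡ ι R′
      qM≡ = trans (cong (q *_) (ι-^ m (suc m))) (trans (sym (^-distrib-* ρ (ι m) (suc m)))
        (trans (cong (_^ suc m) ρm≡r) (sym (ι-^ r (suc m)))))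

  -- Here `o` is the optimum, `w` and `v` count leaves and inner vertices, and `z` and `E` are terms
  -- of the sequences for the LP value and e. The first bounds give o ≤ γ w - 2. As `z` is known
  -- only to be at least `w - 1`, passing from `w` to `z` costs up to γ ≤ 2, which the 2 pays for.
  ratio-bound : ∀ {o w v q μ z E ε} .{{_ : NonZero z}} .{{_ : NonZero E}} → Positive z → Positive E →
    0ℚ ≤ q → q ≤ 1ℚ → 0ℚ ≤ μ → (μ + μ) + (μ + μ) ≤ 1ℚ →
    o + q * w ≤ w + (v + v) → v + 1ℚ ≤ μ * w → w ≤ z + 1ℚ →
    1ℚ ≤ (q + (μ + μ)) * E → (μ + μ) + (μ + μ) ≤ ε →
    o * 1/ z ≤ 1ℚ - 1/ E + ε
  ratio-bound {o} {w} {v} {q} {μ} {z} {E} {ε} z>0 E>0 0≤q q≤1 0≤μ 4μ≤1 saved inner≤ w≤z+1 1≤E 4μ≤ε = begin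
    o * 1/ z                           ≤⟨ *-monoʳ 0≤1/z o≤γz ⟩
    γ * z * 1/ z                       ≡⟨ trans (*-assoc γ z (1/ z)) (cong (γ *_) (*-inverseʳ z)) ⟩
    γ * 1ℚ                             ≡⟨ solve 2 (λ q μ → (con 1ℚ :- q :+ (μ :+ μ)) :* con 1ℚ
                                            := con 1ℚ :- (q :+ (μ :+ μ)) :+ ((μ :+ μ) :+ (μ :+ μ))) refl q μ ⟩
    1ℚ - (q + (μ + μ)) + ((μ + μ) + (μ + μ))
                                       ≤⟨ +-mono-≤ (+-monoʳ-≤ 1ℚ (neg-antimono-≤ 1/E≤)) 4μ≤ε ⟩
    1ℚ - 1/ E + ε                      ∎
    where
    open ≤-Reasoning
    open +-*-Solver
    γ = 1ℚ - q + (μ + μ)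

    0≤1/z : 0ℚ ≤ 1/ z
    0≤1/z = <⇒≤ (positive⁻¹ _ {{1/pos⇒pos z {{z>0}}}})

    0≤1/E : 0ℚ ≤ 1/ E
    0≤1/E = <⇒≤ (positive⁻¹ _ {{1/pos⇒pos E {{E>0}}}})

    1/E≤ : 1/ E ≤ q + (μ + μ)
    1/E≤ = begin
      1/ E                        ≡⟨ *-identityˡ (1/ E) ⟨
      1ℚ * 1/ E                   ≤⟨ *-monoʳ 0≤1/E 1≤E ⟩
      (q + (μ + μ)) * E * 1/ E    ≡⟨ trans (*-assoc (q + (μ + μ)) E (1/ E)) (cong ((q + (μ + μ)) *_) (*-inverseʳ E)) ⟩
      (q + (μ + μ)) * 1ℚ          ≡⟨ *-identityʳ (q + (μ + μ)) ⟩
      q + (μ + μ)                 ∎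

    0≤γ : 0ℚ ≤ γ
    0≤γ = 0≤-+ (subst (_≤ 1ℚ - q) (+-inverseʳ q) (+-monoˡ-≤ (- q) q≤1)) (0≤-+ 0≤μ 0≤μ)

    γ≤2 : γ ≤ 1ℚ + 1ℚ
    γ≤2 = +-mono-≤ (subst (1ℚ - q ≤_) (+-identityʳ 1ℚ) (+-monoʳ-≤ 1ℚ (neg-antimono-≤ 0≤q)))
      (≤-trans (≤-+ʳ (μ + μ) (0≤-+ 0≤μ 0≤μ)) 4μ≤1)

    o≤γz : o ≤ γ * z
    o≤γz = begin
      o
        ≡⟨ solve 3 (λ o q w → o := (o :+ q :* w) :- q :* w) refl o q w ⟩
      (o + q * w) - q * w
        ≤⟨ +-monoˡ-≤ (- (q * w)) saved ⟩
      (w + (v + v)) - q * w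
        ≡⟨ solve 3 (λ w v q → (w :+ (v :+ v)) :- q :* w
             := ((v :+ con 1ℚ) :+ (v :+ con 1ℚ)) :+ (w :- q :* w :- (con 1ℚ :+ con 1ℚ))) refl w v q ⟩
      ((v + 1ℚ) + (v + 1ℚ)) + (w - q * w - (1ℚ + 1ℚ))
        ≤⟨ +-monoˡ-≤ _ (+-mono-≤ inner≤ inner≤) ⟩
      (μ * w + μ * w) + (w - q * w - (1ℚ + 1ℚ))
        ≡⟨ solve 3 (λ w μ q → (μ :* w :+ μ :* w) :+ (w :- q :* w :- (con 1ℚ :+ con 1ℚ))
             := (con 1ℚ :- q :+ (μ :+ μ)) :* w :- (con 1ℚ :+ con 1ℚ)) refl w μ q ⟩
      γ * w - (1ℚ + 1ℚ)
        ≤⟨ +-mono-≤ (*-monoˡ 0≤γ w≤z+1) (neg-antimono-≤ γ≤2) ⟩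
      γ * (z + 1ℚ) - γ
        ≡⟨ solve 2 (λ γ z → γ :* (z :+ con 1ℚ) :- γ := γ :* z) refl γ z ⟩
      γ * z ∎

-- Choice of the parameters and the gap

open import Data.Bool.Base using (false)
import Data.Integer.Base as ℤ
open import Data.Nat.Base as ℕ using (ℕ; suc; _!)
open import Data.Nat.Divisibility using (_∣_; n∣m*n; ∣-trans)
import Data.Nat.Properties as ℕₚ
open import Data.Product.Base using (_×_; _,_; proj₁; proj₂; ∃-syntax; Σ-syntax)
open import Data.Rational.Base as ℚ using (ℚ; 0ℚ; 1ℚ)
import Data.Rational.Properties as ℚₚ
open import Relation.Binary.PropositionalEquality
open import Relation.Nullary using (does)
open import Defs
open Trees
open Combinatorics
open Construction using (denominator; denominator-positive; build; unmarked-build; leaves-build;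
                               inners-build; label-root-build; build-confined; leafWeight-build)
open Firefighting
open Exponential

-- Saved and unmarked vertices together are the `W` leaves and the inner vertices; the second copy
-- of `inners t` is the allowance in `unmarked-build`.
saved-bound : ∀ r s W → denominator r s 0 ∣ W → (let t = build r false s 0 0 W) → ∀ U →
  r ℕ.^ s ℕ.* W ℕ.+ suc r ℕ.^ s ℕ.* #saved (firefighter t) U ℕ.≤
  suc r ℕ.^ s ℕ.* (W ℕ.+ (inners t ℕ.+ inners t))
saved-bound r s W D∣W U = begin
  r ℕ.^ s ℕ.* W ℕ.+ M ℕ.* σ          ≤⟨ ℕₚ.+-monoˡ-≤ (M ℕ.* σ) (unmarked-build r false s 0 0 W ℕ.z≤n D∣W
                                          (picks t U) saved (λ _ ()) (saved-sound t U)) ⟩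
  M ℕ.* (u ℕ.+ ν) ℕ.+ M ℕ.* σ        ≡⟨ ℕₚ.*-distribˡ-+ M (u ℕ.+ ν) σ ⟨
  M ℕ.* (u ℕ.+ ν ℕ.+ σ)              ≡⟨ cong (M ℕ.*_) (trans (ℕₚ.+-comm (u ℕ.+ ν) σ) (sym (ℕₚ.+-assoc σ u ν))) ⟩
  M ℕ.* (σ ℕ.+ u ℕ.+ ν)              ≡⟨ cong (λ x → M ℕ.* (x ℕ.+ ν)) (marked+unmarked t (saved? I U)) ⟩
  M ℕ.* (leaves t ℕ.+ ν ℕ.+ ν)       ≡⟨ cong (M ℕ.*_) (ℕₚ.+-assoc (leaves t) ν ν) ⟩
  M ℕ.* (leaves t ℕ.+ (ν ℕ.+ ν))     ≡⟨ cong (λ x → M ℕ.* (x ℕ.+ (ν ℕ.+ ν))) (leaves-build r false s 0 0 W D∣W) ⟩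
  M ℕ.* (W ℕ.+ (ν ℕ.+ ν))            ∎
  where
  open ℕₚ.≤-Reasoning
  t = build r false s 0 0 W
  I = firefighter t
  M = suc r ℕ.^ s
  ν = inners t
  σ = #saved I U
  saved = λ v → does (saved? I U v)
  u = unmarked t saved

fine-mesh : ∀ δ → 0ℚ ℚ.< δ → ∃[ r-1 ] (let open Mesh r-1 in
  (μ ℚ.+ μ) ℚ.+ (μ ℚ.+ μ) ℚ.≤ δ × (μ ℚ.+ μ) ℚ.+ (μ ℚ.+ μ) ℚ.≤ 1ℚ)
fine-mesh δ 0<δ =
  let (N , _ , 1/N!≤δ) = archimedes δ 0<δ
      n = N !
      -- The summand `4 * n` brings 4/m below 1/n, the summand 4 brings it below 1. The witness
      -- given is `m - 2`, as `Mesh r-1` has mesh number `r-1 + 2`.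
      m = 4 ℕ.+ 4 ℕ.* n
      4μ : (ℤ.+ 1 ℚ./ m ℚ.+ ℤ.+ 1 ℚ./ m) ℚ.+ (ℤ.+ 1 ℚ./ m ℚ.+ ℤ.+ 1 ℚ./ m) ≡ ℤ.+ 4 ℚ./ m
      4μ = trans (cong₂ ℚ._+_ (/-+ 1 1 m) (/-+ 1 1 m)) (/-+ 2 2 m)
  in 2 ℕ.+ 4 ℕ.* n
   , ℚₚ.≤-trans (ℚₚ.≤-reflexive 4μ) (ℚₚ.≤-trans
       (/-≤ 4 1 m n {{_}} {{ℕₚ._!≢0 N}}
         (ℕₚ.≤-trans (ℕₚ.m≤n+m (4 ℕ.* n) 4) (ℕₚ.≤-reflexive (sym (ℕₚ.*-identityˡ m)))))
       1/N!≤δ)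
   , ℚₚ.≤-trans (ℚₚ.≤-reflexive 4μ)
       (/-≤ 4 1 m 1 (ℕₚ.≤-trans (ℕₚ.m≤m+n 4 (4 ℕ.* n)) (ℕₚ.≤-reflexive (sym (ℕₚ.*-identityˡ m)))))

module Gap (r-1 : ℕ) where

  open Mesh r-1

  4μ : ℚ
  4μ = (μ ℚ.+ μ) ℚ.+ (μ ℚ.+ μ)

  -- Counting inner vertices at leaf parameter 0 avoids circularity. The factor `D` makes all
  -- divisions of `W` exact, and `m * suc ν` makes `ν + 1` at most the fraction `μ` of `W`.
  ν D A W : ℕ
  ν = inners (build r false (suc m) 0 0 0)
  D = denominator r (suc m) 0
  A = suc ν ℕ.* D
  W = m ℕ.* A

  t : Tree
  t = build r false (suc m) 0 0 W

  D∣W : D ∣ W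
  D∣W = ∣-trans (n∣m*n (suc ν)) (n∣m*n m)

  ν<A : suc ν ℕ.≤ A
  ν<A = ℕₚ.m≤m*n (suc ν) D {{ℕ.>-nonZero (denominator-positive r (suc m) 0)}}

  2≤W : 2 ℕ.≤ W
  2≤W = ℕₚ.*-mono-≤ {2} {m} {1} {A} (ℕ.s≤s (ℕ.s≤s ℕ.z≤n)) (ℕₚ.≤-trans (ℕ.s≤s ℕ.z≤n) ν<A)

  ν+1≤μW : ι ν ℚ.+ 1ℚ ℚ.≤ μ ℚ.* ι W
  ν+1≤μW = begin
    ι ν ℚ.+ 1ℚ              ≡⟨ ι-+ ν 1 ⟨
    ι (ν ℕ.+ 1)             ≡⟨ cong ι (ℕₚ.+-comm ν 1) ⟩
    ι (suc ν)               ≤⟨ ι-mono ν<A ⟩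
    ι A                     ≡⟨ ℚₚ.*-identityˡ (ι A) ⟨
    1ℚ ℚ.* ι A              ≡⟨ cong (ℚ._* ι A) (trans (ℚₚ.*-comm μ (ι m)) mμ≡1) ⟨
    μ ℚ.* ι m ℚ.* ι A       ≡⟨ ℚₚ.*-assoc μ (ι m) (ι A) ⟩
    μ ℚ.* (ι m ℚ.* ι A)     ≡⟨ cong (μ ℚ.*_) (ι-* m A) ⟨
    μ ℚ.* ι W               ∎
    where open ℚₚ.≤-Reasoning

  opt-bound : ∀ opt → IsOPT (firefighter t) opt → ι opt ℚ.+ q ℚ.* ι W ℚ.≤ ι W ℚ.+ (ι ν ℚ.+ ι ν)
  opt-bound _ ((U , refl) , _) = rationalise {#saved (firefighter t) U} {W} {ν}
    (subst (λ n → r ℕ.^ suc m ℕ.* W ℕ.+ m ℕ.^ suc m ℕ.* #saved (firefighter t) U ℕ.≤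
                  m ℕ.^ suc m ℕ.* (W ℕ.+ (n ℕ.+ n)))
      (inners-build r false (suc m) 0 0 W 0) (saved-bound r (suc m) W D∣W U))

  W≤lp : ∀ lp → IsLP (firefighter t) lp → fromℕ W ≤ lp
  W≤lp lp isLP = subst (λ n → fromℕ n ≤ lp) (leaves-build r false (suc m) 0 0 W D∣W)
    (Fractional.leaves≤lp t m (label-root-build r false (suc m) 0 0 W)
      (λ d → proj₁ (build-confined r false (suc m) 0 0 W ℕ.z≤n d))
      (leafWeight-build r false (suc m) 0 0 W) lp isLP)

  -- The inequality already holds between terms of the Cauchy sequences. The maxima with `1ℚ` and
  -- `1/ 0 !` are the truncated denominators in the inverses of the LP value and of e.
  estimate : ∀ opt → IsOPT (firefighter t) opt → 4μ ℚ.≤ 1ℚ → ∀ n → r ℕ.≤ n →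
    ∀ {l ε} (0<1 : 0ℚ ℚ.< 1ℚ) (0<1/0! : 0ℚ ℚ.< 1/ 0 !) → ι W ℚ.≤ l ℚ.+ 1ℚ → 4μ ℚ.≤ ε →
    ι opt ℚ.* (ℚ.1/ (l ℚ.⊔ 1ℚ)) {{⊔-nonZero l 0<1}} ℚ.≤
    1ℚ ℚ.- (ℚ.1/ (e-seq n ℚ.⊔ 1/ 0 !)) {{⊔-nonZero (e-seq n) 0<1/0!}} ℚ.+ ε
  estimate opt isOPT 4μ≤1 n r≤n {l} {ε} 0<1 0<1/0! W≤l+1 4μ≤ε =
    ratio-bound {ι opt} {ι W} {ι ν} {q} {μ} {l ℚ.⊔ 1ℚ} {e-seq n ℚ.⊔ 1/ 0 !} {ε}
      {{⊔-nonZero l 0<1}} {{⊔-nonZero (e-seq n) 0<1/0!}}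
      (⊔-pos l 0<1) (⊔-pos (e-seq n) 0<1/0!) 0≤q q≤1 0≤μ 4μ≤1
      (opt-bound opt isOPT) ν+1≤μW
      (ℚₚ.≤-trans W≤l+1 (ℚₚ.+-monoˡ-≤ 1ℚ (ℚₚ.p≤p⊔q l 1ℚ)))
      (1≤[q+2μ]E (ℚₚ.≤-trans (e-mono (ℕₚ.≤⇒≤′ r≤n)) (ℚₚ.p≤p⊔q (e-seq n) (1/ 0 !)))
        -- `1/ 0 !` evaluates to 1, so the truncation itself shows that the denominator is at least
        -- 1.
        (ℚₚ.p≤q⊔p (e-seq n) (1/ 0 !)))
      4μ≤ε

  integrality-gap : ∀ ε δ → 4μ ℚ.≤ δ → 4μ ℚ.≤ 1ℚ →
    ∃[ K ] (∀ n → K ℕ.≤ n → seq 0ℝ n ℚ.+ δ ℚ.≤ seq ε n) →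
    ∀ opt lp → IsOPT (firefighter t) opt → IsLP (firefighter t) lp →
    Σ[ lp>0 ∈ 0ℝ < lp ] (fromℕ opt / lp [ lp>0 ] ≤ 1ℝ - 1/ e [ 0<e ] + ε)
  integrality-gap ε δ 4μ≤δ 4μ≤1 (K , δ≤ε) opt lp isOPT isLP = lp>0 , λ η 0<η →
    -- From `N` on the terms of `lp` are at least `W - 1`, from `r` on those of e dominate
    -- `e-seq r`, and from `K` on those of `ε` are at least `δ`.
    N ℕ.⊔ (r ℕ.⊔ K) , λ n ≤n → ℚₚ.≤-trans
      (estimate opt isOPT 4μ≤1 n (≤⊔ˡ {r} {K} (≤⊔ʳ {N} ≤n)) {seq lp n} {seq ε n} 0<1 (proj₁ (proj₂ 0<e))
        (W≤lp+1 n (≤⊔ˡ {N} ≤n))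
        (ℚₚ.≤-trans 4μ≤δ (subst (ℚ._≤ seq ε n) (ℚₚ.+-identityˡ δ) (δ≤ε n (≤⊔ʳ {r} {K} (≤⊔ʳ {N} ≤n))))))
      (≤-+ʳ (seq (1ℝ - 1/ e [ 0<e ] + ε) n) (ℚₚ.<⇒≤ 0<η))
    where
    0<1 : 0ℚ ℚ.< 1ℚ
    0<1 = ℚₚ.positive⁻¹ 1ℚ

    N : ℕ
    N = proj₁ (W≤lp lp isLP 1ℚ 0<1)

    W≤lp+1 : ∀ n → N ℕ.≤ n → ι W ℚ.≤ seq lp n ℚ.+ 1ℚ
    W≤lp+1 = proj₂ (W≤lp lp isLP 1ℚ 0<1)

    cancel-1 : ∀ {p} → 1ℚ ℚ.+ 1ℚ ℚ.≤ p ℚ.+ 1ℚ → 1ℚ ℚ.≤ p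
    cancel-1 {p} 2≤ = subst (1ℚ ℚ.≤_)
      (trans (ℚₚ.+-assoc p 1ℚ (ℚ.- 1ℚ)) (ℚₚ.+-identityʳ p))
      (ℚₚ.+-monoˡ-≤ (ℚ.- 1ℚ) 2≤)

    -- The terms of `lp` are eventually at least `W - 1`, hence at least 1; the witness 1 is also
    -- the truncation level in `estimate`.
    lp>0 : 0ℝ < lp
    lp>0 = 1ℚ , 0<1 , N , λ n N≤n → cancel-1 (ℚₚ.≤-trans (ι-mono {2} {W} 2≤W) (W≤lp+1 n N≤n))

theorem1 : (ε : ℝ) → 0ℝ < ε →
    Σ[ I ∈ Instance ]
    ((opt : ℕ) (lp : ℝ) → IsOPT I opt → IsLP I lp →
    Σ[ lp>0 ∈ 0ℝ < lp ]
    (fromℕ opt / lp [ lp>0 ] ≤ 1ℝ - 1/ e [ 0<e ] + ε))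
theorem1 ε (δ , 0<δ , δ≤ε) =
  let (r-1 , 4μ≤δ , 4μ≤1) = fine-mesh δ 0<δ
  in firefighter (Gap.t r-1) , Gap.integrality-gap r-1 ε δ 4μ≤δ 4μ≤1 δ≤ε
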